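{- For every integer $d \ge 2$ and every real $\epsilon > 0$, there exist a constant $C_d < \frac{1}{2}+\epsilon$ and a threshold $t(\epsilon)$ (both chosen after $d$ and $\epsilon$ are given) such that for all integers $t \ge t(\epsilon)$ there is a family $\mathcal{F}_t= \{(A^1_i, A^2_i,\ldots, A^d_i) : 1\leq i\leq t \}$ of $t$ $d$-tuples of finite sets with the property that, for all $i,i'\in\{1,\dots,t\}$ and $j,j'\in\{1,\dots,d\}$, $A^j_i \cap A^{j'}_{i'}=\emptyset$ if and only if $i= i'$ and $j\neq j'$, and $$\sum_{i=1}^{t}\sum_{j=1}^{d} |A^j_i| \le C_d\, d\, t\log_2 t.$$
   Context: The superscript $j$ in $A_i^j$ is an index (position in the $d$-tuple), not a power. The property with $i=i'$, $j=j'$ says in particular that every $A_i^j$ is nonempty. -}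

module Defs where

open import Data.Fin.Base using (Fin)
open import Data.Fin.Subset using (Subset; _∩_; ⊥) renaming (∣_∣ to card)
open import Data.Integer.Base as ℤ using (+_; +[1+_]; -[1+_]; +≤+)
import Data.Integer.Properties as ℤ
import Data.Integer.Solver as ℤ
open import Data.Nat.Base as ℕ using (ℕ; zero; suc; z≤n; s≤s; ⌊_/2⌋)
open import Data.Nat.Induction using (<-rec)
open import Data.Nat.Logarithm using (⌊log₂_⌋; ⌊log₂⌋-mono-≤; ⌊log₂⌊n/2⌋⌋≡⌊log₂n⌋∸1; ⌊log₂[2^n]⌋≡n)
import Data.Nat.Properties as ℕ
open import Algebra.Properties.Monoid.Sum ℕ.+-0-monoid using (sum-syntax)
open import Data.Product.Base using (_×_; _,_; ∃-syntax)
open import Data.Rational.Base as ℚ using (ℚ; mkℚ; 0ℚ; 1ℚ; ½; ∣_∣; toℚᵘ)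
import Data.Rational.Properties as ℚ
import Data.Rational.Solver as ℚ
open import Data.Rational.Unnormalised.Base as ℚᵘ using (mkℚᵘ; *≤*; *≡*)
import Data.Rational.Unnormalised.Properties as ℚᵘ
open import Data.Sum.Base using (inj₁; inj₂)
open import Function.Bundles using (_⇔_)
open import Relation.Binary.PropositionalEquality using (_≡_; _≢_; refl; sym; trans; cong; cong₂; subst; subst₂)
open import Relation.Nullary using (yes; no; contradiction)

------------------------------------------------------------------------
-- Real numbers as Cauchy sequences of rationals.  Equality of reals is
-- not needed: it would be `x ≤ y × y ≤ x`.

Cauchy : (ℕ → ℚ) → Set
Cauchy s = ∀ δ → 0ℚ ℚ.< δ →
           ∃[ N ] (∀ m n → N ℕ.≤ m → N ℕ.≤ n → ∣ s m ℚ.- s n ∣ ℚ.≤ δ)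

record ℝ : Set where
  constructor mkℝ
  field
    seq    : ℕ → ℚ
    cauchy : Cauchy seq

open ℝ public

infix 4 _<_ _≤_

_<_ : ℝ → ℝ → Set
x < y = ∃[ δ ] (0ℚ ℚ.< δ × ∃[ N ] (∀ n → N ℕ.≤ n → seq x n ℚ.+ δ ℚ.≤ seq y n))

_≤_ : ℝ → ℝ → Set
x ≤ y = ∀ δ → 0ℚ ℚ.< δ → ∃[ N ] (∀ n → N ℕ.≤ n → seq x n ℚ.≤ seq y n ℚ.+ δ)

private
  0<½*δ : ∀ {δ} → 0ℚ ℚ.< δ → 0ℚ ℚ.< ½ ℚ.* δ
  0<½*δ {δ} 0<δ =
    ℚ.positive⁻¹ _ {{ℚ.pos*pos⇒pos ½ δ {{ℚ.positive 0<δ}}}}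

  ½δ+½δ≡δ : ∀ δ → ½ ℚ.* δ ℚ.+ ½ ℚ.* δ ≡ δ
  ½δ+½δ≡δ δ = trans (sym (ℚ.*-distribʳ-+ δ ½ ½)) (ℚ.*-identityˡ δ)

  ∣p-q∣≤δ : ∀ p q δ → p ℚ.≤ q ℚ.+ δ → q ℚ.≤ p ℚ.+ δ → ∣ p ℚ.- q ∣ ℚ.≤ δ
  ∣p-q∣≤δ p q δ p≤q+δ q≤p+δ with ℚ.∣p∣≡p∨∣p∣≡-p (p ℚ.- q)
  ... | inj₁ eq = subst₂ ℚ._≤_ (sym eq)
                    (solve 2 (λ q δ → q :+ δ :- q := δ) refl q δ)
                    (ℚ.+-monoˡ-≤ (ℚ.- q) p≤q+δ)
    where open ℚ.+-*-Solver
  ... | inj₂ eq = subst₂ ℚ._≤_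
                    (trans (solve 2 (λ p q → q :- p := :- (p :- q)) refl p q) (sym eq))
                    (solve 2 (λ p δ → p :+ δ :- p := δ) refl p δ)
                    (ℚ.+-monoˡ-≤ (ℚ.- p) q≤p+δ)
    where open ℚ.+-*-Solver

fromℚ : ℚ → ℝ
fromℚ q = mkℝ (λ _ → q) λ δ 0<δ → 0 , λ _ _ _ _ →
  subst (ℚ._≤ δ) (sym (cong ∣_∣ (ℚ.+-inverseʳ q))) (ℚ.<⇒≤ 0<δ)

fromℕ : ℕ → ℝ
fromℕ n = fromℚ (+ n ℚ./ 1)

infixl 6 _+_

_+_ : ℝ → ℝ → ℝ
x + y = mkℝ (λ n → seq x n ℚ.+ seq y n) λ δ 0<δ →
  let (M , p) = cauchy x (½ ℚ.* δ) (0<½*δ 0<δ)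
      (N , q) = cauchy y (½ ℚ.* δ) (0<½*δ 0<δ)
  in M ℕ.⊔ N , λ m n M⊔N≤m M⊔N≤n →
    let a  = seq x m
        a′ = seq x n
        b  = seq y m
        b′ = seq y n
        open ℚ.+-*-Solver
        open ℚ.≤-Reasoning
    in begin
      ∣ (a ℚ.+ b) ℚ.- (a′ ℚ.+ b′) ∣
        ≡⟨ cong ∣_∣ (solve 4 (λ a b a′ b′ → (a :+ b) :- (a′ :+ b′) := (a :- a′) :+ (b :- b′)) refl a b a′ b′) ⟩
      ∣ (a ℚ.- a′) ℚ.+ (b ℚ.- b′) ∣
        ≤⟨ ℚ.∣p+q∣≤∣p∣+∣q∣ (a ℚ.- a′) (b ℚ.- b′) ⟩
      ∣ a ℚ.- a′ ∣ ℚ.+ ∣ b ℚ.- b′ ∣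
        ≤⟨ ℚ.+-mono-≤ (p m n (ℕ.m⊔n≤o⇒m≤o M N M⊔N≤m) (ℕ.m⊔n≤o⇒m≤o M N M⊔N≤n))
                      (q m n (ℕ.m⊔n≤o⇒n≤o M N M⊔N≤m) (ℕ.m⊔n≤o⇒n≤o M N M⊔N≤n)) ⟩
      ½ ℚ.* δ ℚ.+ ½ ℚ.* δ
        ≡⟨ ½δ+½δ≡δ δ ⟩
      δ ∎

private
  bounded : ∀ x → ∃[ B ] (0ℚ ℚ.< B × ∃[ N ] (∀ n → N ℕ.≤ n → ∣ seq x n ∣ ℚ.≤ B))
  bounded x =
    let (N , p) = cauchy x 1ℚ (ℚ.positive⁻¹ 1ℚ)
        c = seq x N
        open ℚ.+-*-Solver
        open ℚ.≤-Reasoning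
    in 1ℚ ℚ.+ ∣ c ∣
     , ℚ.positive⁻¹ _ {{ℚ.pos+nonNeg⇒pos 1ℚ ∣ c ∣ {{ℚ.∣-∣-nonNeg c}}}}
     , N
     , λ n N≤n → begin
         ∣ seq x n ∣
           ≡⟨ cong ∣_∣ (solve 2 (λ a c → a := (a :- c) :+ c) refl (seq x n) c) ⟩
         ∣ (seq x n ℚ.- c) ℚ.+ c ∣
           ≤⟨ ℚ.∣p+q∣≤∣p∣+∣q∣ (seq x n ℚ.- c) c ⟩
         ∣ seq x n ℚ.- c ∣ ℚ.+ ∣ c ∣
           ≤⟨ ℚ.+-monoˡ-≤ ∣ c ∣ (p n N N≤n ℕ.≤-refl) ⟩
         1ℚ ℚ.+ ∣ c ∣ ∎

  ∣p*q∣≤B*η : ∀ p q {B η} → 0ℚ ℚ.< B → ∣ p ∣ ℚ.≤ B → ∣ q ∣ ℚ.≤ η → ∣ p ℚ.* q ∣ ℚ.≤ B ℚ.* η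
  ∣p*q∣≤B*η p q {B} {η} 0<B p≤B q≤η = begin
    ∣ p ℚ.* q ∣         ≡⟨ ℚ.∣p*q∣≡∣p∣*∣q∣ p q ⟩
    ∣ p ∣ ℚ.* ∣ q ∣     ≤⟨ ℚ.*-monoʳ-≤-nonNeg ∣ q ∣ {{ℚ.∣-∣-nonNeg q}} p≤B ⟩
    B ℚ.* ∣ q ∣         ≤⟨ ℚ.*-monoˡ-≤-nonNeg B {{ℚ.nonNegative (ℚ.<⇒≤ 0<B)}} q≤η ⟩
    B ℚ.* η             ∎
    where open ℚ.≤-Reasoning

  split : ∀ B δ → 0ℚ ℚ.< B → 0ℚ ℚ.< δ → ∃[ η ] (0ℚ ℚ.< η × B ℚ.* η ≡ ½ ℚ.* δ)
  split B δ 0<B 0<δ =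
    1/B ℚ.* (½ ℚ.* δ)
    , ℚ.positive⁻¹ _ {{ℚ.pos*pos⇒pos 1/B {{ℚ.1/pos⇒pos B {{B⁺}}}} (½ ℚ.* δ) {{ℚ.positive (0<½*δ 0<δ)}}}}
    , trans (sym (ℚ.*-assoc B 1/B (½ ℚ.* δ)))
        (trans (cong (ℚ._* (½ ℚ.* δ)) (ℚ.*-inverseʳ B {{ℚ.pos⇒nonZero B {{B⁺}}}}))
               (ℚ.*-identityˡ (½ ℚ.* δ)))
    where
    B⁺ : ℚ.Positive B
    B⁺ = ℚ.positive 0<B
    1/B : ℚ
    1/B = (ℚ.1/ B) {{ℚ.pos⇒nonZero B {{B⁺}}}}

infixl 7 _*_

_*_ : ℝ → ℝ → ℝ
x * y = mkℝ (λ n → seq x n ℚ.* seq y n) λ δ 0<δ →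
  let (A , 0<A , K , xb)  = bounded x
      (B , 0<B , L , yb)  = bounded y
      (α , 0<α , Aα≡½δ)   = split A δ 0<A 0<δ
      (β , 0<β , Bβ≡½δ)   = split B δ 0<B 0<δ
      (M , p)             = cauchy x β 0<β
      (N , q)             = cauchy y α 0<α
  in (K ℕ.⊔ L) ℕ.⊔ (M ℕ.⊔ N) , λ m n h≤m h≤n →
    let a   = seq x m
        a′  = seq x n
        b   = seq y m
        b′  = seq y n
        K≤m = ℕ.m⊔n≤o⇒m≤o K L (ℕ.m⊔n≤o⇒m≤o (K ℕ.⊔ L) (M ℕ.⊔ N) h≤m)
        L≤n = ℕ.m⊔n≤o⇒n≤o K L (ℕ.m⊔n≤o⇒m≤o (K ℕ.⊔ L) (M ℕ.⊔ N) h≤n)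
        MN≤m = ℕ.m⊔n≤o⇒n≤o (K ℕ.⊔ L) (M ℕ.⊔ N) h≤m
        MN≤n = ℕ.m⊔n≤o⇒n≤o (K ℕ.⊔ L) (M ℕ.⊔ N) h≤n
        open ℚ.+-*-Solver
        open ℚ.≤-Reasoning
    in begin
      ∣ a ℚ.* b ℚ.- a′ ℚ.* b′ ∣
        ≡⟨ cong ∣_∣ (solve 4 (λ a b a′ b′ → a :* b :- a′ :* b′ := a :* (b :- b′) :+ b′ :* (a :- a′)) refl a b a′ b′) ⟩
      ∣ a ℚ.* (b ℚ.- b′) ℚ.+ b′ ℚ.* (a ℚ.- a′) ∣
        ≤⟨ ℚ.∣p+q∣≤∣p∣+∣q∣ (a ℚ.* (b ℚ.- b′)) (b′ ℚ.* (a ℚ.- a′)) ⟩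
      ∣ a ℚ.* (b ℚ.- b′) ∣ ℚ.+ ∣ b′ ℚ.* (a ℚ.- a′) ∣
        ≤⟨ ℚ.+-mono-≤
             (∣p*q∣≤B*η a (b ℚ.- b′) 0<A (xb m K≤m)
               (q m n (ℕ.m⊔n≤o⇒n≤o M N MN≤m) (ℕ.m⊔n≤o⇒n≤o M N MN≤n)))
             (∣p*q∣≤B*η b′ (a ℚ.- a′) 0<B (yb n L≤n)
               (p m n (ℕ.m⊔n≤o⇒m≤o M N MN≤m) (ℕ.m⊔n≤o⇒m≤o M N MN≤n))) ⟩
      A ℚ.* α ℚ.+ B ℚ.* β
        ≡⟨ cong₂ ℚ._+_ Aα≡½δ Bβ≡½δ ⟩
      ½ ℚ.* δ ℚ.+ ½ ℚ.* δ
        ≡⟨ ½δ+½δ≡δ δ ⟩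
      δ ∎

------------------------------------------------------------------------
-- The binary logarithm of a natural number.

2^⌊log₂n⌋≤n : ∀ n → 1 ℕ.≤ n → 2 ℕ.^ ⌊log₂ n ⌋ ℕ.≤ n
2^⌊log₂n⌋≤n = <-rec _ step
  where
  2^k≤2*2^[k∸1] : ∀ k → 2 ℕ.^ k ℕ.≤ 2 ℕ.* 2 ℕ.^ (k ℕ.∸ 1)
  2^k≤2*2^[k∸1] zero    = s≤s z≤n
  2^k≤2*2^[k∸1] (suc k) = ℕ.≤-refl

  2*⌊n/2⌋≤n : ∀ n → 2 ℕ.* ⌊ n /2⌋ ℕ.≤ n
  2*⌊n/2⌋≤n zero          = z≤n
  2*⌊n/2⌋≤n (suc zero)    = z≤n
  2*⌊n/2⌋≤n (suc (suc n)) =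
    subst (ℕ._≤ suc (suc n)) (sym (ℕ.*-distribˡ-+ 2 1 ⌊ n /2⌋)) (s≤s (s≤s (2*⌊n/2⌋≤n n)))

  step : ∀ n → (∀ {m} → m ℕ.< n → 1 ℕ.≤ m → 2 ℕ.^ ⌊log₂ m ⌋ ℕ.≤ m) →
         1 ℕ.≤ n → 2 ℕ.^ ⌊log₂ n ⌋ ℕ.≤ n
  step (suc zero)          rec _ = ℕ.≤-refl
  step n@(suc (suc n-2)) rec _ = begin
    2 ℕ.^ ⌊log₂ n ⌋                      ≤⟨ 2^k≤2*2^[k∸1] ⌊log₂ n ⌋ ⟩
    2 ℕ.* 2 ℕ.^ (⌊log₂ n ⌋ ℕ.∸ 1)        ≡⟨ cong (λ k → 2 ℕ.* 2 ℕ.^ k) (⌊log₂⌊n/2⌋⌋≡⌊log₂n⌋∸1 n) ⟨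
    2 ℕ.* 2 ℕ.^ ⌊log₂ ⌊ n /2⌋ ⌋          ≤⟨ ℕ.*-monoʳ-≤ 2 (rec (ℕ.⌊n/2⌋<n (suc n-2)) (s≤s z≤n)) ⟩
    2 ℕ.* ⌊ n /2⌋                        ≤⟨ 2*⌊n/2⌋≤n n ⟩
    n                                    ∎
    where open ℕ.≤-Reasoning

n<2^[1+⌊log₂n⌋] : ∀ n → n ℕ.< 2 ℕ.^ suc ⌊log₂ n ⌋
n<2^[1+⌊log₂n⌋] n = ℕ.≰⇒> λ 2^≤n → ℕ.<-irrefl refl
  (subst (ℕ._≤ ⌊log₂ n ⌋) (⌊log₂[2^n]⌋≡n (suc ⌊log₂ n ⌋)) (⌊log₂⌋-mono-≤ 2^≤n))

-- The n-th term is k / (1 + n), where 2 ^ k ≤ t ^ (1 + n) < 2 ^ (1 + k);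
-- it lies within 1 / (1 + n) below log₂ t.  For t = 0 this is the junk
-- value 0.
log₂-seq : ℕ → ℕ → ℚ
log₂-seq t n = (+ ⌊log₂ t ℕ.^ suc n ⌋) ℚ./ suc n

private
  /-mono-≤ : ∀ a m b n → a ℕ.* suc n ℕ.≤ b ℕ.* suc m → (+ a) ℚ./ suc m ℚ.≤ (+ b) ℚ./ suc n
  /-mono-≤ a m b n le = ℚ.toℚᵘ-cancel-≤
    (ℚᵘ.≤-respˡ-≃ (ℚᵘ.≃-sym (ℚ.toℚᵘ-fromℚᵘ (mkℚᵘ (+ a) m)))
    (ℚᵘ.≤-respʳ-≃ (ℚᵘ.≃-sym (ℚ.toℚᵘ-fromℚᵘ (mkℚᵘ (+ b) n)))
    (*≤* (subst₂ ℤ._≤_ (ℤ.pos-* a (suc n)) (ℤ.pos-* b (suc m)) (+≤+ le)))))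

  [1+a]/n≡a/n+1/n : ∀ a n → (+ suc a) ℚ./ suc n ≡ (+ a) ℚ./ suc n ℚ.+ (+ 1) ℚ./ suc n
  [1+a]/n≡a/n+1/n a n = ℚ.toℚᵘ-injective (begin
    toℚᵘ ((+ suc a) ℚ./ suc n)
      ≈⟨ ℚ.toℚᵘ-fromℚᵘ (mkℚᵘ (+ suc a) n) ⟩
    mkℚᵘ (+ suc a) n
      ≈⟨ *≡* (trans (cong (ℤ._* (+ suc n ℤ.* + suc n)) (ℤ.pos-+ 1 a))
           (solve 2 (λ a n → (con (+ 1) :+ a) :* (n :* n) := (a :* n :+ con (+ 1) :* n) :* n) refl (+ a) (+ suc n))) ⟩
    mkℚᵘ (+ a) n ℚᵘ.+ mkℚᵘ (+ 1) n
      ≈⟨ ℚᵘ.+-cong (ℚ.toℚᵘ-fromℚᵘ (mkℚᵘ (+ a) n)) (ℚ.toℚᵘ-fromℚᵘ (mkℚᵘ (+ 1) n)) ⟨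
    toℚᵘ ((+ a) ℚ./ suc n) ℚᵘ.+ toℚᵘ ((+ 1) ℚ./ suc n)
      ≈⟨ ℚ.toℚᵘ-homo-+ ((+ a) ℚ./ suc n) ((+ 1) ℚ./ suc n) ⟨
    toℚᵘ ((+ a) ℚ./ suc n ℚ.+ (+ 1) ℚ./ suc n) ∎)
    where
    open ℚᵘ.≃-Reasoning
    open ℤ.+-*-Solver

  1/[1+n]≤δ : ∀ δ → 0ℚ ℚ.< δ → ∀ n → ℚ.↧ₙ δ ℕ.≤ n → (+ 1) ℚ./ suc n ℚ.≤ δ
  1/[1+n]≤δ (mkℚ (+ zero) d c)  0<δ n d≤n = contradiction (ℚ.positive 0<δ) λ ()
  1/[1+n]≤δ (mkℚ -[1+ a ] d c)  0<δ n d≤n = contradiction (ℚ.positive 0<δ) λ ()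
  1/[1+n]≤δ δ@(mkℚ +[1+ a ] d c) 0<δ n d≤n =
    subst ((+ 1) ℚ./ suc n ℚ.≤_) (ℚ.↥p/↧p≡p δ)
      (/-mono-≤ 1 n (suc a) d
        (ℕ.*-mono-≤ {1} {suc a} (s≤s z≤n) (ℕ.m≤n⇒m≤1+n d≤n)))

  module _ (t : ℕ) where
    k : ℕ → ℕ
    k n = ⌊log₂ t ℕ.^ suc n ⌋

    cross : ∀ m n → k m ℕ.* suc n ℕ.≤ suc (k n) ℕ.* suc m
    cross m n with t ℕ.≟ 0
    ... | yes refl = z≤n
    ... | no  t≢0  = ℕ.≮⇒≥ λ lt → ℕ.<-irrefl refl (begin-strict
      2 ℕ.^ (suc (k n) ℕ.* suc m)          ≤⟨ ℕ.^-monoʳ-≤ 2 (ℕ.<⇒≤ lt) ⟩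
      2 ℕ.^ (k m ℕ.* suc n)                ≡⟨ ℕ.^-*-assoc 2 (k m) (suc n) ⟨
      (2 ℕ.^ k m) ℕ.^ suc n                ≤⟨ ℕ.^-monoˡ-≤ (suc n) (2^⌊log₂n⌋≤n (t ℕ.^ suc m) (ℕ.m^n>0 t {{ℕ.≢-nonZero t≢0}} (suc m))) ⟩
      (t ℕ.^ suc m) ℕ.^ suc n              ≡⟨ ℕ.^-*-assoc t (suc m) (suc n) ⟩
      t ℕ.^ (suc m ℕ.* suc n)              ≡⟨ cong (t ℕ.^_) (ℕ.*-comm (suc m) (suc n)) ⟩
      t ℕ.^ (suc n ℕ.* suc m)              ≡⟨ ℕ.^-*-assoc t (suc n) (suc m) ⟨
      (t ℕ.^ suc n) ℕ.^ suc m              <⟨ ℕ.^-monoˡ-< (suc m) (n<2^[1+⌊log₂n⌋] (t ℕ.^ suc n)) ⟩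
      (2 ℕ.^ suc (k n)) ℕ.^ suc m          ≡⟨ ℕ.^-*-assoc 2 (suc (k n)) (suc m) ⟩
      2 ℕ.^ (suc (k n) ℕ.* suc m)          ∎)
      where open ℕ.≤-Reasoning

    close : ∀ δ → 0ℚ ℚ.< δ → ∀ m n → ℚ.↧ₙ δ ℕ.≤ n →
            log₂-seq t m ℚ.≤ log₂-seq t n ℚ.+ δ
    close δ 0<δ m n d≤n = begin
      log₂-seq t m                              ≤⟨ /-mono-≤ (k m) m (suc (k n)) n (cross m n) ⟩
      (+ suc (k n)) ℚ./ suc n                   ≡⟨ [1+a]/n≡a/n+1/n (k n) n ⟩
      log₂-seq t n ℚ.+ (+ 1) ℚ./ suc n          ≤⟨ ℚ.+-monoʳ-≤ (log₂-seq t n) (1/[1+n]≤δ δ 0<δ n d≤n) ⟩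
      log₂-seq t n ℚ.+ δ                        ∎
      where open ℚ.≤-Reasoning

log₂ : ℕ → ℝ
log₂ t = mkℝ (log₂-seq t) λ δ 0<δ → ℚ.↧ₙ δ , λ m n N≤m N≤n →
  ∣p-q∣≤δ (log₂-seq t m) (log₂-seq t n) δ (close t δ 0<δ m n N≤n) (close t δ 0<δ n m N≤m)

------------------------------------------------------------------------
-- Families of t d-tuples of finite sets.  Finitely many finite sets all
-- live in a common finite ground set, which is taken to be `Fin n`.

Family : (t d n : ℕ) → Set
Family t d n = Fin t → Fin d → Subset n

DisjointExactlyWithinTuples : ∀ {t d n} → Family t d n → Set
DisjointExactlyWithinTuples A =
  ∀ i i′ j j′ → (A i j ∩ A i′ j′ ≡ ⊥) ⇔ (i ≡ i′ × j ≢ j′)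

totalSize : ∀ {t d n} → Family t d n → ℕ
totalSize {t} {d} A = ∑[ i < t ] ∑[ j < d ] card (A i j)

{-# OPTIONS --safe #-}

-- A word over [d] is a partition of its positions into d classes, so the sets
-- wanted are the classes of words any two of which show, for all j ≠ j′, the
-- letter j against the letter j′ in some position ("qualitatively independent
-- partitions").  Gargano, Körner and Vaccaro: there are 2 ^ (2 n / d - o(n)) of
-- them of length n.
--
-- Among the words of length d b with every letter occurring b times, two that
-- agree after identifying j and j′ meet in (j , j′), since the count of j is
-- the same in both.  So the pair (j , j′) has a proper colouring whose classes
-- have C(2b , b) words each.  Two colourings c₁, c₂ by k colours give a common
-- proper colouring of the m-tuples of words by only k ^ (m + 1) colours, by
-- recording c₁ of the first entry, c₂ of each entry plus c₁ of the next one
-- modulo k, and c₂ of the last entry.  Doing this for all pairs with m large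
-- and taking a largest colour class costs a factor arbitrarily close to 1 in
-- the logarithm of the size.

module Submission where

open import Data.Bool.Base using (true; false; if_then_else_)
open import Data.Fin.Base using (Fin; zero; suc; toℕ; fromℕ<; inject≤; combine; quotient; remainder; _↑ʳ_)
import Data.Fin.Properties as Fin
open import Data.Fin.Subset using (Subset; _∩_; ⊥; ⁅_⁆) renaming (_∈_ to _∈ˢ_; ∣_∣ to card)
import Data.Fin.Subset.Properties as Subset
open import Data.List.Base as List using (List; []; _∷_; length; filter; deduplicate)
import Data.List.Properties as List
open import Data.List.Membership.Propositional using (_∈_)
open import Data.List.Membership.Propositional.Properties
import Data.List.Membership.Setoid.Properties as SetoidMembership
open import Data.List.Relation.Unary.All as All using (All; []; _∷_)
import Data.List.Relation.Unary.All.Properties as All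
open import Data.List.Relation.Unary.AllPairs using ([]; _∷_)
open import Data.List.Relation.Unary.Any as Any using (here)
import Data.List.Relation.Unary.Any.Properties as Any
import Data.List.Relation.Unary.Unique.DecPropositional.Properties as DecUnique
open import Data.List.Relation.Unary.Unique.Propositional using (Unique)
import Data.List.Relation.Unary.Unique.Propositional.Properties as Unique
open import Data.Nat.Base as ℕ using (ℕ; zero; suc; z≤n; s≤s)
open import Data.Nat.Logarithm using (⌊log₂_⌋; ⌊log₂⌋-mono-≤; ⌊log₂[2^n]⌋≡n)
import Data.Nat.Properties as ℕ
open import Data.Nat.Solver using (module +-*-Solver)
open import Data.Product.Base using (Σ-syntax; ∃-syntax; _×_; _,_; proj₁; proj₂)
open import Data.Sum.Base using (_⊎_; inj₁; inj₂; [_,_]′)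
open import Data.Vec.Base as Vec using (Vec; []; _∷_; _++_; here; there)
import Data.Vec.Properties as Vec
open import Function.Base using (_∘_; id)
open import Function.Bundles using (mk⇔)
open import Relation.Binary.Definitions using (DecidableEquality)
open import Relation.Binary.PropositionalEquality
open import Relation.Nullary using (Dec; yes; no; does; contradiction; ¬_; ¬?; _⊎-dec_)
open import Relation.Unary using (Decidable)

-- Words, proper colourings and their combination

module Colourings where

  open import Data.Nat.Base
  open import Data.Nat.Properties
  open import Data.Nat.DivMod using (_%_; m%n<n; m<n⇒m%n≡m; %-distribˡ-+; [m+n]%n≡m%n)

  Word : ℕ → ℕ → Set
  Word d n = Vec (Fin d) n

  data Meets {d} (j j′ : Fin d) : ∀ {n} → Word d n → Word d n → Set where
    here  : ∀ {n} {x y : Word d n} → Meets j j′ (j ∷ x) (j′ ∷ y)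
    there : ∀ {n a b} {x y : Word d n} → Meets j j′ x y → Meets j j′ (a ∷ x) (b ∷ y)

  Meets-++ˡ : ∀ {d m n} {j j′ : Fin d} {x y : Word d m} {x′ y′ : Word d n} →
              Meets j j′ x y → Meets j j′ (x ++ x′) (y ++ y′)
  Meets-++ˡ here      = here
  Meets-++ˡ (there p) = there (Meets-++ˡ p)

  Meets-++ʳ : ∀ {d m n} {j j′ : Fin d} (x y : Word d m) {x′ y′ : Word d n} →
              Meets j j′ x′ y′ → Meets j j′ (x ++ x′) (y ++ y′)
  Meets-++ʳ []      []      p = p
  Meets-++ʳ (_ ∷ x) (_ ∷ y) p = there (Meets-++ʳ x y p)

  MeetsAll : ∀ {d n} → List (Fin d × Fin d) → Word d n → Word d n → Set
  MeetsAll gs x y = All (λ (j , j′) → Meets j j′ x y) gs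

  -- The graph being coloured joins two indices when their words fail to meet in some pair of `gs`,
  -- in one order or the other. Indices rather than words are coloured, so that tuples can be
  -- coloured digit by digit.
  record Colouring {d n N} (w : Fin N → Word d n) (gs : List (Fin d × Fin d)) (k : ℕ) : Set where
    field
      colour : Fin N → Fin k
      proper : ∀ y y′ → y ≢ y′ → colour y ≡ colour y′ → MeetsAll gs (w y) (w y′)

  open Colouring

  quotient-remainder-injective : ∀ m n {z z′ : Fin (m * n)} → quotient {m} n z ≡ quotient {m} n z′ →
                                 remainder {m} n z ≡ remainder {m} n z′ → z ≡ z′
  quotient-remainder-injective m n {z} {z′} p q = begin
    z                                                  ≡⟨ Fin.combine-remQuot {m} n z ⟨
    combine (quotient {m} n z) (remainder {m} n z)     ≡⟨ cong₂ combine p q ⟩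
    combine (quotient {m} n z′) (remainder {m} n z′)   ≡⟨ Fin.combine-remQuot {m} n z′ ⟩
    z′                                                 ∎
    where open ≡-Reasoning

  -- An index below `N ^ m` stands for the m-tuple of its base `N` digits, leading digit first.
  power : ∀ {d n N} → (Fin N → Word d n) → ∀ m → Fin (N ^ m) → Word d (m * n)
  power         w zero    z = []
  power {N = N} w (suc m) z = w (quotient {N} (N ^ m) z) ++ power w m (remainder {N} (N ^ m) z)

  -- Adding `k ∸ a`, the inverse of `a` modulo `k`, to either residue gives back the second summand.
  +-%-cancelˡ : ∀ a {b c} k .{{_ : NonZero k}} → a < k → b < k → c < k →
                (a + b) % k ≡ (a + c) % k → b ≡ c
  +-%-cancelˡ a {b} {c} k a<k b<k c<k eq = begin
    b                              ≡⟨ shift b b<k ⟨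
    (k ∸ a + (a + b) % k) % k      ≡⟨ cong (λ r → (k ∸ a + r) % k) eq ⟩
    (k ∸ a + (a + c) % k) % k      ≡⟨ shift c c<k ⟩
    c                              ∎
    where
    open ≡-Reasoning
    shift : ∀ b → b < k → (k ∸ a + (a + b) % k) % k ≡ b
    shift b b<k = begin
      (k ∸ a + (a + b) % k) % k                ≡⟨ %-distribˡ-+ (k ∸ a) ((a + b) % k) k ⟩
      ((k ∸ a) % k + (a + b) % k % k) % k      ≡⟨ cong (λ r → ((k ∸ a) % k + r) % k) (m<n⇒m%n≡m (m%n<n (a + b) k)) ⟩
      ((k ∸ a) % k + (a + b) % k) % k          ≡⟨ %-distribˡ-+ (k ∸ a) (a + b) k ⟨
      (k ∸ a + (a + b)) % k                    ≡⟨ cong (_% k) (+-assoc (k ∸ a) a b) ⟨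
      (k ∸ a + a + b) % k                      ≡⟨ cong (λ r → (r + b) % k) (m∸n+n≡m (<⇒≤ a<k)) ⟩
      (k + b) % k                              ≡⟨ cong (_% k) (+-comm k b) ⟩
      (b + k) % k                              ≡⟨ [m+n]%n≡m%n b k ⟩
      b % k                                    ≡⟨ m<n⇒m%n≡m b<k ⟩
      b                                        ∎

  module _ {k : ℕ} .{{_ : NonZero k}} where

    _⊕_ : Fin k → Fin k → Fin k
    a ⊕ b = fromℕ< (m%n<n (toℕ a + toℕ b) k)

    ⊕-cancelˡ : ∀ a {b c} → a ⊕ b ≡ a ⊕ c → b ≡ c
    ⊕-cancelˡ a {b} {c} eq = Fin.toℕ-injective
      (+-%-cancelˡ (toℕ a) k (Fin.toℕ<n a) (Fin.toℕ<n b) (Fin.toℕ<n c)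
        (Fin.fromℕ<-injective _ _ (m%n<n (toℕ a + toℕ b) k) (m%n<n (toℕ a + toℕ c) k) eq))

    ⊕-comm : ∀ a b → a ⊕ b ≡ b ⊕ a
    ⊕-comm a b = Fin.fromℕ<-cong _ _ (cong (_% k) (+-comm (toℕ a) (toℕ b))) _ _

    ⊕-cancelʳ : ∀ a {b c} → b ⊕ a ≡ c ⊕ a → b ≡ c
    ⊕-cancelʳ a {b} {c} eq = ⊕-cancelˡ a (trans (⊕-comm a b) (trans eq (⊕-comm c a)))

  Fin1-irrelevant : (z z′ : Fin 1) → z ≡ z′
  Fin1-irrelevant zero zero = refl

  -- Tuples are coloured entrywise, so the first entries at which two tuples of one colour differ
  -- have equal colours and meet. Here `N` and `k` are raised to the same power, which keeps the
  -- ratio of their logarithms.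
  powerColouring : ∀ {d n N gs k} {w : Fin N → Word d n} →
                   Colouring w gs k → ∀ m → Colouring (power w m) gs (k ^ m)
  powerColouring c zero .colour z = z
  powerColouring c zero .proper z z′ z≢z′ _ = contradiction (Fin1-irrelevant z z′) z≢z′
  powerColouring {N = N} c (suc m) .colour z =
    combine (c .colour (quotient {N} (N ^ m) z)) (powerColouring c m .colour (remainder {N} (N ^ m) z))
  powerColouring {N = N} {w = w} c (suc m) .proper z z′ z≢z′ eq
    with quotient {N} (N ^ m) z Fin.≟ quotient {N} (N ^ m) z′ | Fin.combine-injective _ _ _ _ eq
  ... | no  p≢p′ | eq₁ , _   = All.map Meets-++ˡ (c .proper _ _ p≢p′ eq₁)
  ... | yes p≡p′ | _   , eq₂ = All.map (Meets-++ʳ (w (quotient {N} (N ^ m) z)) (w (quotient {N} (N ^ m) z′)))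
    (powerColouring c m .proper _ _ (z≢z′ ∘ quotient-remainder-injective N (N ^ m) p≡p′) eq₂)

  -- A sequence z = (y₁, …, yₘ) is coloured by head z = c₁ y₁ together with
  -- links z = (c₂ y₁ ⊕ c₁ y₂, …, c₂ yₘ₋₁ ⊕ c₁ yₘ, c₂ yₘ ⊕ const).  Read from the
  -- left, the first difference of two sequences of equal colour is between
  -- entries of equal c₁-colour; read from the right, it is between entries of
  -- equal c₂-colour.
  module Merge {d n N k} .{{_ : NonZero k}} {w : Fin N → Word d n} {gs hs}
               (c₁ : Colouring w gs k) (c₂ : Colouring w hs k) where

    head : ∀ m → Fin (N ^ m) → Fin k
    head zero    _ = fromℕ< (>-nonZero⁻¹ k)
    head (suc m) z = c₁ .colour (quotient {N} (N ^ m) z)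

    links : ∀ m → Fin (N ^ m) → Fin (k ^ m)
    links zero    z = z
    links (suc m) z =
      combine (c₂ .colour (quotient {N} (N ^ m) z) ⊕ head m (remainder {N} (N ^ m) z)) (links m (remainder {N} (N ^ m) z))

    proper₁ : ∀ m z z′ → z ≢ z′ → head m z ≡ head m z′ → links m z ≡ links m z′ →
              MeetsAll gs (power w m z) (power w m z′)
    proper₁ zero    z z′ z≢z′ _ _ = contradiction (Fin1-irrelevant z z′) z≢z′
    proper₁ (suc m) z z′ z≢z′ eq₁ eq₂
      with quotient {N} (N ^ m) z Fin.≟ quotient {N} (N ^ m) z′ | Fin.combine-injective _ _ _ _ eq₂
    ... | no  p≢p′ | _           = All.map Meets-++ˡ (c₁ .proper _ _ p≢p′ eq₁)
    ... | yes p≡p′ | link , eq₂′ = All.map (Meets-++ʳ (w (quotient {N} (N ^ m) z)) (w (quotient {N} (N ^ m) z′)))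
      (proper₁ m _ _ (z≢z′ ∘ quotient-remainder-injective N (N ^ m) p≡p′)
        (⊕-cancelˡ _ (trans link (cong (λ p → c₂ .colour p ⊕ head m (remainder {N} (N ^ m) z′)) (sym p≡p′)))) eq₂′)

    proper₂ : ∀ m z z′ → z ≢ z′ → links m z ≡ links m z′ →
              MeetsAll hs (power w m z) (power w m z′)
    proper₂ zero    z z′ z≢z′ _ = contradiction (Fin1-irrelevant z z′) z≢z′
    proper₂ (suc m) z z′ z≢z′ eq
      with remainder {N} (N ^ m) z Fin.≟ remainder {N} (N ^ m) z′ | Fin.combine-injective _ _ _ _ eq
    ... | no  r≢r′ | _ , eq′  = All.map (Meets-++ʳ (w (quotient {N} (N ^ m) z)) (w (quotient {N} (N ^ m) z′)))
                                        (proper₂ m _ _ r≢r′ eq′)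
    ... | yes r≡r′ | link , _ = All.map Meets-++ˡ
      (c₂ .proper _ _ (λ p≡p′ → z≢z′ (quotient-remainder-injective N (N ^ m) p≡p′ r≡r′))
        (⊕-cancelʳ _ (trans link (cong (λ r → c₂ .colour (quotient {N} (N ^ m) z′) ⊕ head m r) (sym r≡r′)))))

    merge : ∀ m → Colouring (power w m) (gs List.++ hs) (k ^ suc m)
    merge m .colour z = combine (head m z) (links m z)
    merge m .proper z z′ z≢z′ eq =
      let (eq₁ , eq₂) = Fin.combine-injective (head m z) (links m z) (head m z′) (links m z′) eq
      in All.++⁺ (proper₁ m z z′ z≢z′ eq₁ eq₂) (proper₂ m z z′ z≢z′ eq₂)

  enlarge : ∀ {d n N gs k k′} {w : Fin N → Word d n} → k ≤ k′ → Colouring w gs k → Colouring w gs k′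
  enlarge k≤k′ c .colour y = inject≤ (c .colour y) k≤k′
  enlarge k≤k′ c .proper y y′ y≢y′ eq = c .proper y y′ y≢y′ (Fin.inject≤-injective k≤k′ k≤k′ _ _ eq)

  -- With m = 2 Q + 1 this multiplies e / M ≤ 1 + 1 / m by 1 + 1 / m, denominators cleared. It holds
  -- because (2 Q + 2)² Q falls short of (2 Q + 1)² (Q + 1) by exactly Q + 1.
  ratio-step : ∀ Q M e → e * suc (2 * Q) ≤ M * suc (suc (2 * Q)) →
               suc (suc (2 * Q)) * e * Q ≤ suc (2 * Q) * M * suc Q
  ratio-step Q M e h = *-cancelʳ-≤ _ _ (suc (2 * Q)) (begin
    suc (suc (2 * Q)) * e * Q * suc (2 * Q)
      ≡⟨ solve 2 (λ Q e → (con 2 :+ con 2 :* Q) :* e :* Q :* (con 1 :+ con 2 :* Q)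
                       := (con 2 :+ con 2 :* Q) :* Q :* (e :* (con 1 :+ con 2 :* Q))) refl Q e ⟩
    suc (suc (2 * Q)) * Q * (e * suc (2 * Q))
      ≤⟨ *-monoʳ-≤ (suc (suc (2 * Q)) * Q) h ⟩
    suc (suc (2 * Q)) * Q * (M * suc (suc (2 * Q)))
      ≤⟨ m≤m+n _ (M * suc Q) ⟩
    suc (suc (2 * Q)) * Q * (M * suc (suc (2 * Q))) + M * suc Q
      ≡⟨ solve 2 (λ Q M → (con 2 :+ con 2 :* Q) :* Q :* (M :* (con 2 :+ con 2 :* Q)) :+ M :* (con 1 :+ Q)
                       := (con 1 :+ con 2 :* Q) :* M :* (con 1 :+ Q) :* (con 1 :+ con 2 :* Q)) refl Q M ⟩
    suc (2 * Q) * M * suc Q * suc (2 * Q) ∎)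
    where
    open ≤-Reasoning
    open +-*-Solver

  Code : (d n N k : ℕ) → List (Fin d × Fin d) → Set
  Code d n N k gs = Σ[ w ∈ (Fin N → Word d n) ] Colouring w gs k

  resize : ∀ {d n n′ N N′ k k′ gs} → n ≡ n′ → N ≡ N′ → k ≡ k′ → Code d n N k gs → Code d n′ N′ k′ gs
  resize refl refl refl code = code

  -- The excess of `e / M` over 1 measures the loss. All word maps `w` are allowed because the
  -- recursion replaces `w` by its powers; `ʳ++` appears because each merged pair is pushed onto the
  -- accumulator `as`.
  Combines : ∀ {d} → List (Fin d × Fin d) → ℕ → ℕ → Set
  Combines {d} gs M e = ∀ {n N k as} .{{_ : NonZero k}} (w : Fin N → Word d n) →
    Colouring w as k → All (λ g → Colouring w (g ∷ []) k) gs →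
    Code d (M * n) (N ^ M) (k ^ e) (gs List.ʳ++ as)

  -- Merging m = 2 Q + 1 copies costs a factor 1 + 1 / (2 Q + 1), whose square is
  -- at most 1 + 1 / Q.
  combine-all : ∀ {d} (gs : List (Fin d × Fin d)) Q →
                ∃[ M ] ∃[ e ] NonZero M × e * Q ≤ M * suc Q × Combines gs M e
  combine-all []       Q = 1 , 1 , _ , *-monoʳ-≤ 1 (n≤1+n Q) , λ w c _ →
    power w 1 , powerColouring c 1
  combine-all {d} (g ∷ gs) Q =
    let m = suc (2 * Q)
        (M , e , M≢0 , eQ≤M , combines) = combine-all gs m
    in m * M , suc m * e , m*n≢0 m M {{_}} {{M≢0}} , ratio-step Q M e eQ≤M , extend m M e combines
    where
    extend : ∀ m M e → Combines gs M e → Combines (g ∷ gs) (m * M) (suc m * e)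
    extend m M e combines {n} {N} {k} w c (c′ ∷ cs) = resize
      (trans (sym (*-assoc M m n)) (cong (_* n) (*-comm M m)))
      (^-*-assoc N m M)
      (^-*-assoc k (suc m) e)
      (combines {{m^n≢0 k (suc m)}} (power w m) (Merge.merge c′ c m)
        -- The pairs still to be merged use `k ^ m` colours on m-tuples. They are padded to the
        -- `k ^ suc m` of the merged colouring, since all colourings must share one number of
        -- colours.
        (All.map (λ c → enlarge (^-monoʳ-≤ k (n≤1+n m)) (powerColouring c m)) cs))

  -- Pigeonhole principle and extraction of a colour class

  length-filter-¬ : ∀ {a p} {A : Set a} {P : A → Set p} (P? : Decidable P) xs →
                    length (filter P? xs) + length (filter (¬? ∘ P?) xs) ≡ length xs
  length-filter-¬ P? []       = refl
  length-filter-¬ P? (x ∷ xs) with P? x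
  ... | yes _ = cong suc (length-filter-¬ P? xs)
  ... | no  _ = trans (+-suc _ _) (cong suc (length-filter-¬ P? xs))

  -- Either the top colour already has `t` elements, or deleting its class removes fewer than `t`
  -- and leaves one colour less. Colours are natural numbers below a bound, so the induction can
  -- lower the bound without recoding them.
  pigeonhole : ∀ {a} {A : Set a} (c : A → ℕ) k t xs → Unique xs → All (λ x → c x < suc k) xs →
               t * suc k ≤ length xs →
               ∃[ ys ] ∃[ v ] Unique ys × All (λ y → c y ≡ v) ys × t ≤ length ys
  pigeonhole c zero    t xs uniq c<1 t≤ =
    xs , 0 , uniq , All.map (n≤0⇒n≡0 ∘ s≤s⁻¹) c<1 , ≤-trans (≤-reflexive (sym (*-identityʳ t))) t≤
  pigeonhole c (suc k) t xs uniq c<k t≤ with t ≤? length (filter ((_≟ suc k) ∘ c) xs)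
  ... | yes t≤ys = filter P? xs , suc k , Unique.filter⁺ P? uniq , All.all-filter P? xs , t≤ys
    where P? = (_≟ suc k) ∘ c
  ... | no  t≰ys = pigeonhole c k t (filter (¬? ∘ P?) xs) (Unique.filter⁺ (¬? ∘ P?) uniq)
    (All.zipWith (λ (c≢ , c<) → ≤∧≢⇒< (s≤s⁻¹ c<) c≢)
      (All.all-filter (¬? ∘ P?) xs , All.filter⁺ (¬? ∘ P?) c<k))
    (+-cancelˡ-≤ t _ _ (begin
      t + t * suc k                                            ≡⟨ *-suc t (suc k) ⟨
      t * suc (suc k)                                          ≤⟨ t≤ ⟩
      length xs                                                ≡⟨ length-filter-¬ P? xs ⟨
      length (filter P? xs) + length (filter (¬? ∘ P?) xs)     ≤⟨ +-monoˡ-≤ _ (<⇒≤ (≰⇒> t≰ys)) ⟩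
      t + length (filter (¬? ∘ P?) xs)                         ∎))
    where
    open ≤-Reasoning
    P? = (_≟ suc k) ∘ c

  lookup-injective : ∀ {a} {A : Set a} {xs : List A} → Unique xs →
                     ∀ i j → List.lookup xs i ≡ List.lookup xs j → i ≡ j
  lookup-injective (_ ∷ _)  zero    zero    _  = refl
  lookup-injective (x∉ ∷ _) zero    (suc j) eq = contradiction eq (All.lookup x∉ (∈-lookup j))
  lookup-injective (x∉ ∷ _) (suc i) zero    eq = contradiction (sym eq) (All.lookup x∉ (∈-lookup i))
  lookup-injective (_ ∷ u)  (suc i) (suc j) eq = cong suc (lookup-injective u i j eq)

  colour-class : ∀ {d n N k gs t} .{{_ : NonZero k}} → Code d n N k gs → t * k ≤ N →
                 Σ[ w ∈ (Fin t → Word d n) ] ∀ i i′ → i ≢ i′ → MeetsAll gs (w i) (w i′)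
  colour-class {N = N} {k = suc k} {t = t} (w , c) tk≤N
    with pigeonhole (toℕ ∘ c .colour) k t (List.allFin N) (Unique.allFin⁺ N)
           (All.universal (λ y → Fin.toℕ<n (c .colour y)) _)
           (≤-trans tk≤N (≤-reflexive (sym (List.length-tabulate {n = N} id))))
  ... | ys , v , uniq , same , t≤ =
    w ∘ pick , λ i i′ i≢i′ → c .proper _ _
      (λ eq → i≢i′ (Fin.inject≤-injective t≤ t≤ i i′ (lookup-injective uniq _ _ eq)))
      (Fin.toℕ-injective (trans (All.lookup same (∈-lookup (inject≤ i t≤)))
                                (sym (All.lookup same (∈-lookup (inject≤ i′ t≤))))))
    where
    pick : Fin t → Fin N
    pick i = List.lookup ys (inject≤ i t≤)

-- From words to families of sets

module Families where

  open import Defs using (DisjointExactlyWithinTuples; totalSize)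
  open import Data.Nat.Base
  open import Data.Nat.Properties
  open import Algebra.Properties.CommutativeMonoid.Sum +-0-commutativeMonoid using (sum-syntax; sum-cong-≗; ∑-distrib-+)
  open Colourings

  -- The last d points of the ground set make A i j ∩ A i′ j nonempty.
  tupleOf : ∀ {d n} → Word d n → Fin d → Subset (n + d)
  tupleOf x j = Vec.map (λ a → does (a Fin.≟ j)) x ++ ⁅ j ⁆

  does-≟-refl : ∀ {d} (j : Fin d) → does (j Fin.≟ j) ≡ true
  does-≟-refl j with j Fin.≟ j
  ... | yes _  = refl
  ... | no j≢j = contradiction refl j≢j

  Meets⇒common : ∀ {d n} {j j′ : Fin d} {x y : Word d n} → Meets j j′ x y →
                 ∃[ q ] q ∈ˢ tupleOf x j × q ∈ˢ tupleOf y j′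
  Meets⇒common {j = j} {j′} {_ ∷ x} {_ ∷ y} here = zero ,
    subst (λ b → zero ∈ˢ (b ∷ tupleOf x j)) (sym (does-≟-refl j)) here ,
    subst (λ b → zero ∈ˢ (b ∷ tupleOf y j′)) (sym (does-≟-refl j′)) here
  Meets⇒common (there p) with Meets⇒common p
  ... | q , q∈ , q∈′ = suc q , there q∈ , there q∈′

  ↑ʳ-∈-tupleOf : ∀ {d n} (x : Word d n) j → (n ↑ʳ j) ∈ˢ tupleOf x j
  ↑ʳ-∈-tupleOf []      j = Subset.x∈⁅x⁆ j
  ↑ʳ-∈-tupleOf (_ ∷ x) j = there (↑ʳ-∈-tupleOf x j)

  ⁅⁆-disjoint : ∀ {d} {j j′ : Fin d} → j ≢ j′ → ⁅ j ⁆ ∩ ⁅ j′ ⁆ ≡ ⊥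
  ⁅⁆-disjoint {_} {zero}  {zero}   j≢j′ = contradiction refl j≢j′
  ⁅⁆-disjoint {_} {zero}  {suc j′} j≢j′ = cong (false ∷_) (Subset.∩-zeroˡ ⁅ j′ ⁆)
  ⁅⁆-disjoint {_} {suc j} {zero}   j≢j′ = cong (false ∷_) (Subset.∩-zeroʳ ⁅ j ⁆)
  ⁅⁆-disjoint {_} {suc j} {suc j′} j≢j′ = cong (false ∷_) (⁅⁆-disjoint (j≢j′ ∘ cong suc))

  tupleOf-disjoint : ∀ {d n} (x : Word d n) {j j′} → j ≢ j′ → tupleOf x j ∩ tupleOf x j′ ≡ ⊥
  tupleOf-disjoint []      j≢j′ = ⁅⁆-disjoint j≢j′
  tupleOf-disjoint (a ∷ x) {j} {j′} j≢j′ with a Fin.≟ j | a Fin.≟ j′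
  ... | yes a≡j | yes a≡j′ = contradiction (trans (sym a≡j) a≡j′) j≢j′
  ... | yes _   | no _     = cong (false ∷_) (tupleOf-disjoint x j≢j′)
  ... | no _    | _        = cong (false ∷_) (tupleOf-disjoint x j≢j′)

  -- For j = j′ the added point of j is common to both sets. For j ≠ j′ the sets are disjoint
  -- classes of one word if i = i′, and otherwise share the position where the two words meet.
  tupleOf-family : ∀ {t d n} (w : Fin t → Word d n) →
    (∀ i i′ j j′ → i ≢ i′ → j ≢ j′ → Meets j j′ (w i) (w i′)) →
    DisjointExactlyWithinTuples (λ i → tupleOf (w i))
  tupleOf-family {n = n} w meets i i′ j j′ = mk⇔ to from
    where
    from : i ≡ i′ × j ≢ j′ → tupleOf (w i) j ∩ tupleOf (w i′) j′ ≡ ⊥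
    from (refl , j≢j′) = tupleOf-disjoint (w i) j≢j′

    to : tupleOf (w i) j ∩ tupleOf (w i′) j′ ≡ ⊥ → i ≡ i′ × j ≢ j′
    to eq = cases
      where
      common : ∀ q → q ∈ˢ tupleOf (w i) j → q ∈ˢ tupleOf (w i′) j′ → i ≡ i′ × j ≢ j′
      common q q∈ q∈′ = contradiction (subst (q ∈ˢ_) eq (Subset.x∈p∩q⁺ (q∈ , q∈′))) Subset.∉⊥

      cases : i ≡ i′ × j ≢ j′
      cases with j Fin.≟ j′ | i Fin.≟ i′
      ... | no j≢j′  | yes i≡i′ = i≡i′ , j≢j′
      ... | yes refl | _        = common (n ↑ʳ j) (↑ʳ-∈-tupleOf (w i) j) (↑ʳ-∈-tupleOf (w i′) j)
      ... | no j≢j′  | no i≢i′  with Meets⇒common (meets i i′ j j′ i≢i′ j≢j′)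
      ...   | q , q∈ , q∈′ = common q q∈ q∈′

  sum-const : ∀ n c → ∑[ i < n ] c ≡ n * c
  sum-const zero    c = refl
  sum-const (suc n) c = cong (c +_) (sum-const n c)

  sum-indicator : ∀ {d} (a : Fin d) → ∑[ j < d ] (if does (a Fin.≟ j) then 1 else 0) ≡ 1
  sum-indicator {suc d} zero    = cong suc (trans (sum-const d 0) (*-zeroʳ d))
  sum-indicator {suc d} (suc a) = sum-indicator a

  -- The d sets of a tuple partition the ground set: a position lies only in the class of its
  -- letter, an added point only in its own singleton.
  sum-card-tupleOf : ∀ {d n} (x : Word d n) → ∑[ j < d ] card (tupleOf x j) ≡ n + d
  sum-card-tupleOf {d} []      = begin
    ∑[ j < d ] card ⁅ j ⁆  ≡⟨ sum-cong-≗ {n = d} Subset.∣⁅x⁆∣≡1 ⟩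
    ∑[ j < d ] 1           ≡⟨ sum-const d 1 ⟩
    d * 1                  ≡⟨ *-identityʳ d ⟩
    d                      ∎
    where open ≡-Reasoning
  sum-card-tupleOf {d} {suc n} (a ∷ x) = begin
    ∑[ j < d ] card (tupleOf (a ∷ x) j)
      ≡⟨ sum-cong-≗ (λ j → card-∷ (does (a Fin.≟ j)) (tupleOf x j)) ⟩
    ∑[ j < d ] ((if does (a Fin.≟ j) then 1 else 0) + card (tupleOf x j))
      ≡⟨ ∑-distrib-+ (λ j → if does (a Fin.≟ j) then 1 else 0) (λ j → card (tupleOf x j)) ⟩
    ∑[ j < d ] (if does (a Fin.≟ j) then 1 else 0) + ∑[ j < d ] card (tupleOf x j)
      ≡⟨ cong₂ _+_ (sum-indicator a) (sum-card-tupleOf x) ⟩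
    suc (n + d) ∎
    where
    open ≡-Reasoning
    card-∷ : ∀ {m} b (p : Subset m) → card (b ∷ p) ≡ (if b then 1 else 0) + card p
    card-∷ false p = refl
    card-∷ true  p = refl

  totalSize-tupleOf : ∀ {t d n} (w : Fin t → Word d n) → totalSize (λ i → tupleOf (w i)) ≡ t * (n + d)
  totalSize-tupleOf {t} {d} {n} w = trans (sum-cong-≗ (λ i → sum-card-tupleOf (w i))) (sum-const t (n + d))

-- Fibre counting and letter counts

module Counting where

  open import Data.Nat.Base
  open import Data.Nat.Properties
  open import Algebra.Properties.CommutativeMonoid.Sum +-0-commutativeMonoid using (sum-syntax)
  open Colourings

  index-injective : ∀ {a} {A : Set a} {x y : A} {xs} (p : x ∈ xs) (q : y ∈ xs) →
                    Any.index p ≡ Any.index q → x ≡ y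
  index-injective {A = A} = SetoidMembership.index-injective (setoid A)

  -- φ x parametrises (part of) the fibre of f through x by B, and g recovers the
  -- parameter; so f has at most |T| / |B| values.
  image*fibre≤ : ∀ {a b c} {X : Set a} {A : Set b} {Y : Set c} (_≟_ : DecidableEquality A)
    (T : List X) (f : X → A) (B : List Y) → Unique B → (φ : X → Y → X) (g : X → Y) →
    (∀ {x y} → x ∈ T → y ∈ B → φ x y ∈ T × f (φ x y) ≡ f x × g (φ x y) ≡ y) →
    length (deduplicate _≟_ (List.map f T)) * length B ≤ length T
  image*fibre≤ _≟_ T f B uniqB φ g h = Fin.injective⇒≤ {f = inj} inj-injective
    where
    P = deduplicate _≟_ (List.map f T)

    rep : ∀ i → ∃[ x ] x ∈ T × List.lookup P i ≡ f x
    rep i = ∈-map⁻ f (∈-deduplicate⁻ _≟_ (List.map f T) (∈-lookup i))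

    Z = Fin (length P * length B)

    row : Z → Fin (length P)
    row = quotient {length P} (length B)

    column : Z → Fin (length B)
    column = remainder {length P} (length B)

    val : ∀ z → let x = proj₁ (rep (row z)) ; y = List.lookup B (column z) in
                φ x y ∈ T × f (φ x y) ≡ f x × g (φ x y) ≡ y
    val z = h (proj₁ (proj₂ (rep (row z)))) (∈-lookup (column z))

    inj : Z → Fin (length T)
    inj z = Any.index (proj₁ (val z))

    inj-injective : ∀ {z z′} → inj z ≡ inj z′ → z ≡ z′
    inj-injective {z} {z′} eq = quotient-remainder-injective (length P) (length B)
      (lookup-injective (DecUnique.deduplicate-! _≟_ (List.map f T)) _ _ (begin
        List.lookup P (row z)          ≡⟨ proj₂ (proj₂ (rep (row z))) ⟩
        f (proj₁ (rep (row z)))        ≡⟨ proj₁ (proj₂ (val z)) ⟨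
        f _                            ≡⟨ cong f φ≡ ⟩
        f _                            ≡⟨ proj₁ (proj₂ (val z′)) ⟩
        f (proj₁ (rep (row z′)))       ≡⟨ proj₂ (proj₂ (rep (row z′))) ⟨
        List.lookup P (row z′)         ∎))
      (lookup-injective uniqB _ _ (trans (sym (proj₂ (proj₂ (val z)))) (trans (cong g φ≡) (proj₂ (proj₂ (val z′))))))
      where
      open ≡-Reasoning
      φ≡ = index-injective (proj₁ (val z)) (proj₁ (val z′)) eq

  allWords : ∀ d n → List (Word d n)
  allWords d zero    = [] ∷ []
  allWords d (suc n) = List.cartesianProductWith _∷_ (List.allFin d) (allWords d n)

  ∈-allWords : ∀ {d n} (x : Word d n) → x ∈ allWords d n
  ∈-allWords []      = here refl
  ∈-allWords (a ∷ x) = ∈-cartesianProductWith⁺ _∷_ (∈-allFin a) (∈-allWords x)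

  allWords-unique : ∀ d n → Unique (allWords d n)
  allWords-unique d zero    = [] ∷ []
  allWords-unique d (suc n) =
    Unique.cartesianProductWith⁺ _∷_ Vec.∷-injective (Unique.allFin⁺ d) (allWords-unique d n)

  length-cartesianProductWith : ∀ {a b c} {A : Set a} {B : Set b} {C : Set c} (f : A → B → C) xs ys →
    length (List.cartesianProductWith f xs ys) ≡ length xs * length ys
  length-cartesianProductWith f []       ys = refl
  length-cartesianProductWith f (x ∷ xs) ys = trans (List.length-++ (List.map (f x) ys))
    (cong₂ _+_ (List.length-map (f x) ys) (length-cartesianProductWith f xs ys))

  length-allWords : ∀ d n → length (allWords d n) ≡ d ^ n
  length-allWords d zero    = refl
  length-allWords d (suc n) = trans (length-cartesianProductWith _∷_ (List.allFin d) (allWords d n))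
    (cong₂ _*_ (List.length-tabulate {n = d} id) (length-allWords d n))

  indicator : ∀ {d} → Fin d → Fin d → ℕ
  indicator l a = if does (l Fin.≟ a) then 1 else 0

  indicator-≡ : ∀ {d} (l : Fin d) → indicator l l ≡ 1
  indicator-≡ l with l Fin.≟ l
  ... | yes _  = refl
  ... | no l≢l = contradiction refl l≢l

  indicator-≢ : ∀ {d} {l a : Fin d} → l ≢ a → indicator l a ≡ 0
  indicator-≢ {l = l} {a} l≢a with l Fin.≟ a
  ... | yes l≡a = contradiction l≡a l≢a
  ... | no _    = refl

  occ : ∀ {d n} → Fin d → Word d n → ℕ
  occ l []      = 0
  occ l (a ∷ x) = indicator l a + occ l x

  occᴸ : ∀ {d} → Fin d → List (Fin d) → ℕ
  occᴸ l []      = 0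
  occᴸ l (a ∷ x) = indicator l a + occᴸ l x

  occ-++ : ∀ {d m n} l (x : Word d m) (y : Word d n) → occ l (x ++ y) ≡ occ l x + occ l y
  occ-++ l []      y = refl
  occ-++ l (a ∷ x) y = trans (cong (indicator l a +_) (occ-++ l x y)) (sym (+-assoc (indicator l a) (occ l x) (occ l y)))

  occ-replicate : ∀ {d} n l (a : Fin d) → occ l (Vec.replicate n a) ≡ n * indicator l a
  occ-replicate zero    l a = refl
  occ-replicate (suc n) l a = cong (indicator l a +_) (occ-replicate n l a)

  occ-concat-replicate : ∀ {d n} b l (x : Word d n) →
                         occ l (Vec.concat (Vec.map (Vec.replicate b) x)) ≡ b * occ l x
  occ-concat-replicate b l []      = sym (*-zeroʳ b)
  occ-concat-replicate b l (a ∷ x) = begin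
    occ l (Vec.replicate b a ++ Vec.concat (Vec.map (Vec.replicate b) x))
      ≡⟨ occ-++ l (Vec.replicate b a) _ ⟩
    occ l (Vec.replicate b a) + occ l (Vec.concat (Vec.map (Vec.replicate b) x))
      ≡⟨ cong₂ _+_ (occ-replicate b l a) (occ-concat-replicate b l x) ⟩
    b * indicator l a + b * occ l x
      ≡⟨ *-distribˡ-+ b (indicator l a) (occ l x) ⟨
    b * (indicator l a + occ l x) ∎
    where open ≡-Reasoning

  occ-tabulate : ∀ {d n} l (f : Fin n → Fin d) → occ l (Vec.tabulate f) ≡ ∑[ q < n ] indicator l (f q)
  occ-tabulate {n = zero}  l f = refl
  occ-tabulate {n = suc n} l f = cong (indicator l (f zero) +_) (occ-tabulate l (f ∘ suc))

  -- Arrangements of two letters and central binomial coefficients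

  -- The lists with `p` entries `u` and `q` entries `v`. For `u = j` and `v = j′` they are the
  -- possible fillings of the positions that carry j or j′, and so parametrise the words that agree
  -- once j and j′ are identified.
  arrangements : ∀ {a} {A : Set a} → A → A → ℕ → ℕ → List (List A)
  arrangements u v zero    zero    = [] ∷ []
  arrangements u v zero    (suc q) = List.map (v ∷_) (arrangements u v zero q)
  arrangements u v (suc p) zero    = List.map (u ∷_) (arrangements u v p zero)
  arrangements u v (suc p) (suc q) =
    List.map (u ∷_) (arrangements u v p (suc q)) List.++ List.map (v ∷_) (arrangements u v (suc p) q)

  -- This is C(p + q , p), indexed by the two parts so that Pascal's rule matches the recursion of
  -- `arrangements`.
  binomial : ℕ → ℕ → ℕ
  binomial zero    q       = 1
  binomial (suc p) zero    = 1
  binomial (suc p) (suc q) = binomial p (suc q) + binomial (suc p) q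

  length-arrangements : ∀ {a} {A : Set a} (u v : A) p q → length (arrangements u v p q) ≡ binomial p q
  length-arrangements u v zero    zero    = refl
  length-arrangements u v zero    (suc q) = trans (List.length-map (v ∷_) (arrangements u v zero q)) (length-arrangements u v zero q)
  length-arrangements u v (suc zero) zero = refl
  length-arrangements u v (suc p@(suc _)) zero = trans (List.length-map (u ∷_) (arrangements u v p zero)) (length-arrangements u v p zero)
  length-arrangements u v (suc p) (suc q) = trans (List.length-++ (List.map (u ∷_) (arrangements u v p (suc q))))
    (cong₂ _+_ (trans (List.length-map (u ∷_) (arrangements u v p (suc q))) (length-arrangements u v p (suc q)))
               (trans (List.length-map (v ∷_) (arrangements u v (suc p) q)) (length-arrangements u v (suc p) q)))

  -- By Pascal's rule: the first summand leaves over the factor p + 1, the second q + 1, and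
  -- together they supply the last factor p + q + 2 of the factorial.
  binomial-! : ∀ p q → binomial p q * (p ! * q !) ≡ (p + q) !
  binomial-! zero    q       = trans (*-identityˡ _) (*-identityˡ _)
  binomial-! (suc p) zero    = trans (*-identityˡ _) (trans (*-identityʳ _) (cong (λ n → suc n !) (sym (+-identityʳ p))))
  binomial-! (suc p) (suc q) = begin
    (binomial p (suc q) + binomial (suc p) q) * (suc p ! * suc q !)
      ≡⟨ solve 6 (λ B B′ p q P Q →
           (B :+ B′) :* ((con 1 :+ p) :* P :* ((con 1 :+ q) :* Q))
           := (con 1 :+ p) :* (B :* (P :* ((con 1 :+ q) :* Q))) :+ (con 1 :+ q) :* (B′ :* ((con 1 :+ p) :* P :* Q)))
           refl (binomial p (suc q)) (binomial (suc p) q) p q (p !) (q !) ⟩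
    suc p * (binomial p (suc q) * (p ! * suc q !)) + suc q * (binomial (suc p) q * (suc p ! * q !))
      ≡⟨ cong₂ (λ m n → suc p * m + suc q * n) (binomial-! p (suc q)) (binomial-! (suc p) q) ⟩
    suc p * (p + suc q) ! + suc q * (suc p + q) !
      ≡⟨ cong (λ n → suc p * (p + suc q) ! + suc q * n !) (sym (+-suc p q)) ⟩
    suc p * (p + suc q) ! + suc q * (p + suc q) !
      ≡⟨ *-distribʳ-+ ((p + suc q) !) (suc p) (suc q) ⟨
    (suc p + suc q) ! ∎
    where
    open ≡-Reasoning
    open +-*-Solver

  -- This is 4 ^ b ≤ (2 b + 1) C(2b , b), multiplied out. From b to b + 1 the left side grows by the
  -- factor 4 (b + 1)² and the right side by (2 b + 2) (2 b + 3), which is larger by 2 (b + 1).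
  central-lower : ∀ b → 4 ^ b * (b ! * b !) ≤ (b + b) ! * suc (2 * b)
  central-lower zero    = ≤-refl
  central-lower (suc b) = begin
    4 ^ suc b * (suc b ! * suc b !)
      ≡⟨ solve 3 (λ X b F → con 4 :* X :* ((con 1 :+ b) :* F :* ((con 1 :+ b) :* F))
           := con 4 :* (con 1 :+ b) :* (con 1 :+ b) :* (X :* (F :* F))) refl (4 ^ b) b (b !) ⟩
    4 * suc b * suc b * (4 ^ b * (b ! * b !))
      ≤⟨ *-monoʳ-≤ (4 * suc b * suc b) (central-lower b) ⟩
    4 * suc b * suc b * ((b + b) ! * suc (2 * b))
      ≤⟨ m≤m+n _ (2 * suc b * ((b + b) ! * suc (2 * b))) ⟩
    4 * suc b * suc b * ((b + b) ! * suc (2 * b)) + 2 * suc b * ((b + b) ! * suc (2 * b))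
      ≡⟨ solve 2 (λ b G → con 4 :* (con 1 :+ b) :* (con 1 :+ b) :* (G :* (con 1 :+ con 2 :* b))
             :+ con 2 :* (con 1 :+ b) :* (G :* (con 1 :+ con 2 :* b))
           := (con 1 :+ (con 1 :+ (b :+ b))) :* ((con 1 :+ (b :+ b)) :* G) :* (con 1 :+ con 2 :* (con 1 :+ b)))
           refl b ((b + b) !) ⟩
    suc (suc (b + b)) * (suc (b + b) * (b + b) !) * suc (2 * suc b)
      ≡⟨ cong (λ n → suc n ! * suc (2 * suc b)) (+-suc b b) ⟨
    (suc b + suc b) ! * suc (2 * suc b) ∎
    where
    open ≤-Reasoning
    open +-*-Solver

  4^b≤binomial : ∀ b → 4 ^ b ≤ binomial b b * suc (2 * b)
  4^b≤binomial b = *-cancelʳ-≤ _ _ (b ! * b !) {{m*n≢0 (b !) (b !) {{b !≢0}} {{b !≢0}}}} (begin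
    4 ^ b * (b ! * b !)                             ≤⟨ central-lower b ⟩
    (b + b) ! * suc (2 * b)                         ≡⟨ cong (_* suc (2 * b)) (binomial-! b b) ⟨
    binomial b b * (b ! * b !) * suc (2 * b)        ≡⟨ *-assoc (binomial b b) _ _ ⟩
    binomial b b * (b ! * b ! * suc (2 * b))        ≡⟨ cong (binomial b b *_) (*-comm (b ! * b !) _) ⟩
    binomial b b * (suc (2 * b) * (b ! * b !))      ≡⟨ *-assoc (binomial b b) _ _ ⟨
    binomial b b * suc (2 * b) * (b ! * b !)        ∎)
    where open ≤-Reasoning

  module _ {a} {A : Set a} {u v : A} where

    arrangements-unique : u ≢ v → ∀ p q → Unique (arrangements u v p q)
    arrangements-unique u≢v zero    zero    = [] ∷ []
    arrangements-unique u≢v zero    (suc q) = Unique.map⁺ List.∷-injectiveʳ (arrangements-unique u≢v zero q)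
    arrangements-unique u≢v (suc p) zero    = Unique.map⁺ List.∷-injectiveʳ (arrangements-unique u≢v p zero)
    arrangements-unique u≢v (suc p) (suc q) = Unique.++⁺
      (Unique.map⁺ List.∷-injectiveʳ (arrangements-unique u≢v p (suc q)))
      (Unique.map⁺ List.∷-injectiveʳ (arrangements-unique u≢v (suc p) q))
      λ (w∈ , w∈′) → let (_ , _ , eq) = ∈-map⁻ (u ∷_) w∈ ; (_ , _ , eq′) = ∈-map⁻ (v ∷_) w∈′
                     in u≢v (List.∷-injectiveˡ (trans (sym eq) eq′))

    -- Membership in `arrangements` as an inductive predicate, from which length, letters and letter
    -- counts follow by structural recursion.
    data Arrangement : ℕ → ℕ → List A → Set a where
      []  : Arrangement 0 0 []
      u∷_ : ∀ {p q w} → Arrangement p q w → Arrangement (suc p) q (u ∷ w)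
      v∷_ : ∀ {p q w} → Arrangement p q w → Arrangement p (suc q) (v ∷ w)

    ∈-arrangements⁻ : ∀ p q {w} → w ∈ arrangements u v p q → Arrangement p q w
    ∈-arrangements⁻ zero    zero    (here refl) = []
    ∈-arrangements⁻ zero    (suc q) w∈ with ∈-map⁻ (v ∷_) w∈
    ... | _ , w′∈ , refl = v∷ ∈-arrangements⁻ zero q w′∈
    ∈-arrangements⁻ (suc p) zero    w∈ with ∈-map⁻ (u ∷_) w∈
    ... | _ , w′∈ , refl = u∷ ∈-arrangements⁻ p zero w′∈
    ∈-arrangements⁻ (suc p) (suc q) w∈ with ∈-++⁻ (List.map (u ∷_) (arrangements u v p (suc q))) w∈
    ... | inj₁ w∈ˡ with ∈-map⁻ (u ∷_) w∈ˡ
    ...   | _ , w′∈ , refl = u∷ ∈-arrangements⁻ p (suc q) w′∈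
    ∈-arrangements⁻ (suc p) (suc q) w∈ | inj₂ w∈ʳ with ∈-map⁻ (v ∷_) w∈ʳ
    ...   | _ , w′∈ , refl = v∷ ∈-arrangements⁻ (suc p) q w′∈

    length-Arrangement : ∀ {p q w} → Arrangement p q w → length w ≡ p + q
    length-Arrangement []            = refl
    length-Arrangement (u∷ w)        = cong suc (length-Arrangement w)
    length-Arrangement (v∷_ {p} {q} w) = trans (cong suc (length-Arrangement w)) (sym (+-suc p q))

    Arrangement-letters : ∀ {p q w} → Arrangement p q w → All (λ a → a ≡ u ⊎ a ≡ v) w
    Arrangement-letters []     = []
    Arrangement-letters (u∷ w) = inj₁ refl ∷ Arrangement-letters w
    Arrangement-letters (v∷ w) = inj₂ refl ∷ Arrangement-letters w

  -- Identifying two letters of a word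

  module Pair {d} {j j′ : Fin d} (j≢j′ : j ≢ j′) where

    InPair : Fin d → Set
    InPair a = a ≡ j ⊎ a ≡ j′

    inPair? : ∀ a → Dec (InPair a)
    inPair? a = (a Fin.≟ j) ⊎-dec (a Fin.≟ j′)

    occᴸ-Arrangement : ∀ {p q w} → Arrangement {u = j} {j′} p q w → occᴸ j w ≡ p × occᴸ j′ w ≡ q
    occᴸ-Arrangement []     = refl , refl
    occᴸ-Arrangement (u∷ w) = let (eq , eq′) = occᴸ-Arrangement w in
      cong₂ _+_ (indicator-≡ j) eq , cong₂ _+_ (indicator-≢ (j≢j′ ∘ sym)) eq′
    occᴸ-Arrangement (v∷ w) = let (eq , eq′) = occᴸ-Arrangement w in
      cong₂ _+_ (indicator-≢ j≢j′) eq , cong₂ _+_ (indicator-≡ j′) eq′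

    mergeLetter : Fin d → Fin d
    mergeLetter a with inPair? a
    ... | yes _ = j
    ... | no _  = a

    merge : ∀ {n} → Word d n → Word d n
    merge = Vec.map mergeLetter

    extract : ∀ {n} → Word d n → List (Fin d)
    extract []      = []
    extract (a ∷ x) with inPair? a
    ... | yes _ = a ∷ extract x
    ... | no _  = extract x

    refill : ∀ {n} → Word d n → List (Fin d) → Word d n
    refill []      w = []
    refill (a ∷ x) w with inPair? a | w
    ... | no _  | w     = a ∷ refill x w
    -- Default when the list runs out: the old letter stays. It belongs to the pair, so the image
    -- under `merge` is the same in this case too.
    ... | yes _ | []    = a ∷ refill x []
    ... | yes _ | c ∷ w = c ∷ refill x w

    mergeLetter-yes : ∀ {a} → InPair a → mergeLetter a ≡ j
    mergeLetter-yes {a} p with inPair? a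
    ... | yes _ = refl
    ... | no ¬p = contradiction p ¬p

    mergeLetter-no : ∀ {a} → ¬ InPair a → mergeLetter a ≡ a
    mergeLetter-no {a} ¬p with inPair? a
    ... | yes p = contradiction p ¬p
    ... | no _  = refl

    extract-yes : ∀ {n a} {x : Word d n} → InPair a → extract (a ∷ x) ≡ a ∷ extract x
    extract-yes {a = a} p with inPair? a
    ... | yes _ = refl
    ... | no ¬p = contradiction p ¬p

    extract-no : ∀ {n a} {x : Word d n} → ¬ InPair a → extract (a ∷ x) ≡ extract x
    extract-no {a = a} ¬p with inPair? a
    ... | yes p = contradiction p ¬p
    ... | no _  = refl

    extract-refill : ∀ {n} (x : Word d n) {w} → All InPair w → length w ≡ length (extract x) →
                     extract (refill x w) ≡ w
    extract-refill []      {[]} []  _  = refl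
    extract-refill (a ∷ x) {w}  ps  eq with inPair? a | w
    extract-refill (a ∷ x) ps       eq | no ¬p | w     = trans (extract-no ¬p) (extract-refill x ps eq)
    extract-refill (a ∷ x) (p ∷ ps) eq | yes _ | c ∷ w =
      trans (extract-yes p) (cong (c ∷_) (extract-refill x ps (suc-injective eq)))

    merge-refill : ∀ {n} (x : Word d n) {w} → All InPair w → merge (refill x w) ≡ merge x
    merge-refill []      _  = refl
    merge-refill (a ∷ x) {w} ps with inPair? a | w
    merge-refill (a ∷ x) ps       | no ¬p | w     = cong₂ _∷_ (mergeLetter-no ¬p) (merge-refill x ps)
    merge-refill (a ∷ x) []       | yes p | []    = cong₂ _∷_ (mergeLetter-yes p) (merge-refill x [])
    merge-refill (a ∷ x) (q ∷ ps) | yes p | c ∷ w = cong₂ _∷_ (mergeLetter-yes q) (merge-refill x ps)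

    occ-extract : ∀ {n l} → InPair l → (x : Word d n) → occ l x ≡ occᴸ l (extract x)
    occ-extract         p []      = refl
    occ-extract {l = l} p (a ∷ x) with inPair? a
    ... | yes _ = cong (indicator l a +_) (occ-extract p x)
    ... | no ¬p = cong₂ _+_ (indicator-≢ {l = l} {a} λ l≡a → ¬p (subst InPair l≡a p)) (occ-extract p x)

    occ-merge : ∀ {n l} → ¬ InPair l → (x : Word d n) → occ l (merge x) ≡ occ l x
    occ-merge         ¬p []      = refl
    occ-merge {l = l} ¬p (a ∷ x) with inPair? a
    ... | yes p = cong₂ _+_ (trans (indicator-≢ (λ l≡j → ¬p (inj₁ l≡j)))
                                   (sym (indicator-≢ {l = l} {a} λ l≡a → ¬p (subst InPair (sym l≡a) p)))) (occ-merge ¬p x)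
    ... | no _  = cong (indicator l a +_) (occ-merge ¬p x)

    length-extract : ∀ {n} (x : Word d n) → length (extract x) ≡ occ j x + occ j′ x
    length-extract []      = refl
    length-extract (a ∷ x) with inPair? a
    ... | yes (inj₁ refl) = trans (cong suc (length-extract x))
      (cong₂ _+_ (cong (_+ occ j x) (sym (indicator-≡ j))) (cong (_+ occ j′ x) (sym (indicator-≢ (j≢j′ ∘ sym)))))
    ... | yes (inj₂ refl) = trans (cong suc (length-extract x)) (trans (sym (+-suc (occ j x) (occ j′ x)))
      (cong₂ _+_ (cong (_+ occ j x) (sym (indicator-≢ j≢j′))) (cong (_+ occ j′ x) (sym (indicator-≡ j′)))))
    ... | no ¬p = trans (length-extract x)
      (cong₂ _+_ (cong (_+ occ j x) (sym (indicator-≢ (¬p ∘ inj₁ ∘ sym))))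
                 (cong (_+ occ j′ x) (sym (indicator-≢ (¬p ∘ inj₂ ∘ sym)))))

    -- Where x and y differ and do not meet, x has j′ and y has j.
    merge-≡ : ∀ {n} (x y : Word d n) → merge x ≡ merge y →
              Meets j j′ x y ⊎ x ≡ y ⊎ occ j x < occ j y
    merge-≡ []      []      _  = inj₂ (inj₁ refl)
    merge-≡ (a ∷ x) (b ∷ y) eq with Vec.∷-injective eq
    ... | eq₁ , eq₂ with merge-≡ x y eq₂ | letters a b eq₁
      where
      letters : ∀ a b → mergeLetter a ≡ mergeLetter b → (a ≡ j × b ≡ j′) ⊎ a ≡ b ⊎ (a ≡ j′ × b ≡ j)
      letters a b eq with inPair? a | inPair? b
      ... | no _              | no _            = inj₂ (inj₁ eq)
      ... | no ¬p             | yes _           = contradiction (inj₁ eq) ¬p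
      ... | yes _             | no ¬p           = contradiction (inj₁ (sym eq)) ¬p
      ... | yes (inj₁ p)      | yes (inj₂ q)    = inj₁ (p , q)
      ... | yes (inj₂ p)      | yes (inj₁ q)    = inj₂ (inj₂ (p , q))
      ... | yes (inj₁ p)      | yes (inj₁ q)    = inj₂ (inj₁ (trans p (sym q)))
      ... | yes (inj₂ p)      | yes (inj₂ q)    = inj₂ (inj₁ (trans p (sym q)))
    ...   | _                | inj₁ (refl , refl)        = inj₁ here
    ...   | inj₁ m           | _                         = inj₁ (there m)
    ...   | inj₂ (inj₁ refl) | inj₂ (inj₁ refl)          = inj₂ (inj₁ refl)
    ...   | inj₂ (inj₂ lt)   | inj₂ (inj₁ refl)          = inj₂ (inj₂ (+-monoʳ-< (indicator j a) lt))
    -- This position adds one j to y and none to x, so a weak inequality between the tails suffices;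
    -- `r` gives it whether the tails are equal or already strictly ordered.
    ...   | inj₂ r           | inj₂ (inj₂ (refl , refl)) = inj₂ (inj₂ (subst₂ _<_
      (cong (_+ occ j x) (sym (indicator-≢ j≢j′))) (cong (_+ occ j y) (sym (indicator-≡ j)))
      (s≤s ([ (λ { refl → ≤-refl }) , <⇒≤ ]′ r))))

-- Balanced words and the colouring for one pair of letters

module BalancedWords where

  open import Data.Nat.Base
  open import Data.Nat.Properties
  open import Data.Nat.DivMod using (_/_; m/n*n≤m; m*n/n≡m; /-monoˡ-≤)
  open Colourings
  open Families using (sum-indicator)
  open Counting

  binomial-nonZero : ∀ p q → NonZero (binomial p q)
  binomial-nonZero zero    q       = _
  binomial-nonZero (suc p) zero    = _
  binomial-nonZero (suc p) (suc q) =
    >-nonZero (≤-trans (>-nonZero⁻¹ (binomial p (suc q)) {{binomial-nonZero p (suc q)}}) (m≤m+n _ _))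

  module Balanced (d b : ℕ) where

    IsBalanced : ∀ {n} → Word d n → Set
    IsBalanced x = ∀ l → occ l x ≡ b

    balanced? : ∀ {n} (x : Word d n) → Dec (IsBalanced x)
    balanced? x = Fin.all? λ l → occ l x ≟ b

    words : List (Word d (d * b))
    words = filter balanced? (allWords d (d * b))

    words-unique : Unique words
    words-unique = Unique.filter⁺ balanced? (allWords-unique d (d * b))

    ∈-words⁺ : ∀ {x} → IsBalanced x → x ∈ words
    ∈-words⁺ {x} bal = ∈-filter⁺ balanced? (∈-allWords x) bal

    ∈-words⁻ : ∀ {x} → x ∈ words → IsBalanced x
    ∈-words⁻ x∈ = proj₂ (∈-filter⁻ balanced? {xs = allWords d (d * b)} x∈)

    N : ℕ
    N = length words

    N≤d^[d*b] : N ≤ d ^ (d * b)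
    N≤d^[d*b] = ≤-trans (List.length-filter balanced? (allWords d (d * b))) (≤-reflexive (length-allWords d (d * b)))

    -- The witness is the word of d blocks, one for each letter, of b equal letters each. Its
    -- existence is what makes `k` nonzero.
    someIndex : Fin N
    someIndex = Any.index (∈-words⁺ {Vec.concat (Vec.map (Vec.replicate b) (Vec.allFin d))} λ l → begin
      occ l (Vec.concat (Vec.map (Vec.replicate b) (Vec.allFin d)))  ≡⟨ occ-concat-replicate b l (Vec.allFin d) ⟩
      b * occ l (Vec.allFin d)                                       ≡⟨ cong (b *_) (trans (occ-tabulate l id) (sum-indicator l)) ⟩
      b * 1                                                          ≡⟨ *-identityʳ b ⟩
      b                                                              ∎)
      where open ≡-Reasoning

    word : Fin N → Word d (d * b)
    word = List.lookup words

    -- One number of colours for every pair of letters, as `Combines` demands. Rounding down is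
    -- harmless: the number of merged patterns is an integer whose product with `binomial b b` is at
    -- most `N`.
    k : ℕ
    k = (N / binomial b b) {{binomial-nonZero b b}}

    k*binomial≤N : k * binomial b b ≤ N
    k*binomial≤N = m/n*n≤m N (binomial b b) {{binomial-nonZero b b}}

    module _ {j j′ : Fin d} (j≢j′ : j ≢ j′) where
      open Pair j≢j′

      _≟ʷ_ : DecidableEquality (Word d (d * b))
      _≟ʷ_ = Vec.≡-dec Fin._≟_

      -- The fibre of `merge` through x: the 2 b positions of j and j′ may be refilled by any
      -- arrangement of b letters each. This is the hypothesis of `image*fibre≤`.
      refill-balanced : ∀ {x w} → x ∈ words → w ∈ arrangements j j′ b b →
        refill x w ∈ words × merge (refill x w) ≡ merge x × extract (refill x w) ≡ w
      refill-balanced {x} {w} x∈ w∈ = ∈-words⁺ balanced , merged , extracted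
        where
        arr = ∈-arrangements⁻ b b w∈
        merged = merge-refill x (Arrangement-letters arr)
        extracted = extract-refill x (Arrangement-letters arr) (trans (length-Arrangement arr)
          (sym (trans (length-extract x) (cong₂ _+_ (∈-words⁻ x∈ j) (∈-words⁻ x∈ j′)))))
        open ≡-Reasoning
        balanced : IsBalanced (refill x w)
        -- Letters outside the pair are counted after `merge`, which refilling does not change; the
        -- letters of the pair are counted in the extracted list, which is the arrangement `w`.
        balanced l with inPair? l
        ... | no ¬p = begin
          occ l (refill x w)           ≡⟨ occ-merge ¬p (refill x w) ⟨
          occ l (merge (refill x w))   ≡⟨ cong (occ l) merged ⟩
          occ l (merge x)              ≡⟨ occ-merge ¬p x ⟩
          occ l x                      ≡⟨ ∈-words⁻ x∈ l ⟩
          b                            ∎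
        ... | yes p = begin
          occ l (refill x w)                 ≡⟨ occ-extract p (refill x w) ⟩
          occᴸ l (extract (refill x w))      ≡⟨ cong (occᴸ l) extracted ⟩
          occᴸ l w                           ≡⟨ [ (λ { refl → proj₁ (occᴸ-Arrangement arr) })
                                                , (λ { refl → proj₂ (occᴸ-Arrangement arr) }) ]′ p ⟩
          b                                  ∎

      patterns : List (Word d (d * b))
      patterns = deduplicate _≟ʷ_ (List.map merge words)

      patterns≤k : length patterns ≤ k
      patterns≤k = begin
        length patterns                                        ≡⟨ m*n/n≡m (length patterns) (binomial b b) ⟨
        length patterns * binomial b b / binomial b b          ≤⟨ /-monoˡ-≤ (binomial b b) (begin
          length patterns * binomial b b                         ≡⟨ cong (length patterns *_) (length-arrangements j j′ b b) ⟨
          length patterns * length (arrangements j j′ b b)       ≤⟨ image*fibre≤ _≟ʷ_ words merge (arrangements j j′ b b)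
                                                                      (arrangements-unique j≢j′ b b) refill extract refill-balanced ⟩
          N                                                      ∎) ⟩
        N / binomial b b ∎
        where
        open ≤-Reasoning
        instance _ = binomial-nonZero b b

      -- The colour of a word is its image under `merge`. By `merge-≡`, two words of one colour that
      -- do not meet in (j , j′) are equal or contain j a different number of times, and balance
      -- excludes the latter.
      pairColouring : Colouring word ((j , j′) ∷ []) k
      pairColouring = record
        { colour = λ y → inject≤ (Any.index (pattern∈ y)) patterns≤k
        ; proper = λ y y′ y≢y′ eq → meets y y′ y≢y′
            (index-injective (pattern∈ y) (pattern∈ y′) (Fin.inject≤-injective _ _ _ _ eq)) ∷ []
        }
        where
        pattern∈ : ∀ y → merge (word y) ∈ patterns
        pattern∈ y = ∈-deduplicate⁺ _≟ʷ_ (∈-map⁺ merge (∈-lookup y))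

        meets : ∀ y y′ → y ≢ y′ → merge (word y) ≡ merge (word y′) → Meets j j′ (word y) (word y′)
        meets y y′ y≢y′ eq with merge-≡ (word y) (word y′) eq
        ... | inj₁ m         = m
        ... | inj₂ (inj₁ e)  = contradiction (lookup-injective words-unique y y′ e) y≢y′
        ... | inj₂ (inj₂ lt) = contradiction
          (trans (∈-words⁻ (∈-lookup y) j) (sym (∈-words⁻ (∈-lookup y′) j))) (<⇒≢ lt)

      k-nonZero : NonZero k
      k-nonZero = Fin.nonZeroIndex (Colouring.colour pairColouring someIndex)

-- All pairs of letters at once

module Parameters where

  open import Defs using (n<2^[1+⌊log₂n⌋])
  open import Data.Nat.Base
  open import Data.Nat.Properties
  open import Data.Nat.DivMod using (_/_; _%_; m/n*n≤m; m/n≤m; m≡m%n+[m/n]*n; m%n<n)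
  open Colourings
  open Counting
  open BalancedWords

  distinctPairs : ∀ d → List (Fin d × Fin d)
  distinctPairs d = filter (λ (j , j′) → ¬? (j Fin.≟ j′)) (List.cartesianProduct (List.allFin d) (List.allFin d))

  distinctPairs-≢ : ∀ d → All (λ (j , j′) → j ≢ j′) (distinctPairs d)
  distinctPairs-≢ d = All.all-filter (λ (j , j′) → ¬? (j Fin.≟ j′)) (List.cartesianProduct (List.allFin d) (List.allFin d))

  QualitativelyIndependent : ∀ {t d n} → (Fin t → Word d n) → Set
  QualitativelyIndependent w = ∀ i i′ j j′ → i ≢ i′ → j ≢ j′ → Meets j j′ (w i) (w i′)

  module _ (d : ℕ) where
    open Balanced (suc (suc d))

    -- `M` and `e` depend on the alphabet and `Q` only, so they are fixed before `b` is made to grow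
    -- with `t`. The inequality on `t` is the pigeonhole bound for `k ^ e` colours.
    independentWords : ∀ Q → ∃[ M ] ∃[ e ] NonZero M × e * Q ≤ M * suc Q ×
      (∀ b t → t * k b ^ e ≤ N b ^ M →
       Σ[ w ∈ (Fin t → Word (suc (suc d)) (M * (suc (suc d) * b))) ] QualitativelyIndependent w)
    independentWords Q =
      let (M , e , M≢0 , eQ≤ , combines) = combine-all (distinctPairs (suc (suc d))) Q
      in M , e , M≢0 , eQ≤ , λ b t h →
        -- The accumulator needs some colouring to start from. The letters 0 and 1 exist because the
        -- alphabet has at least two letters; their pair comes up again in `distinctPairs`.
        let c₀ = pairColouring b {zero} {suc zero} λ ()
            k≢0 = k-nonZero b {zero} {suc zero} λ ()
            (w , meets) = colour-class {{m^n≢0 (k b) e {{k≢0}}}}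
              (combines {{k≢0}} (word b) c₀ (All.map (λ j≢j′ → pairColouring b j≢j′) (distinctPairs-≢ (suc (suc d))))) h
        in w , λ i i′ j j′ i≢i′ j≢j′ → All.lookup (meets i i′ i≢i′)
          (Any.reverseAcc⁺ _ (distinctPairs (suc (suc d))) (inj₂
            (∈-filter⁺ (λ (j , j′) → ¬? (j Fin.≟ j′)) (∈-cartesianProduct⁺ (∈-allFin j) (∈-allFin j′)) j≢j′)))

  -- Numerical estimates and choice of the parameters

  n≤2^n : ∀ n → n ≤ 2 ^ n
  n≤2^n zero    = z≤n
  n≤2^n (suc n) = begin
    suc n            ≤⟨ +-mono-≤ (m^n>0 2 n) (n≤2^n n) ⟩
    2 ^ n + 2 ^ n    ≡⟨ cong (2 ^ n +_) (+-identityʳ (2 ^ n)) ⟨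
    2 ^ suc n        ∎
    where open ≤-Reasoning

  [4+n]²≤2^[4+n] : ∀ n → (4 + n) * (4 + n) ≤ 2 ^ (4 + n)
  [4+n]²≤2^[4+n] zero    = ≤-refl
  [4+n]²≤2^[4+n] (suc n) = begin
    (5 + n) * (5 + n)                            ≤⟨ m≤m+n _ (7 + 6 * n + n * n) ⟩
    (5 + n) * (5 + n) + (7 + 6 * n + n * n)      ≡⟨ solve 1 (λ n → (con 5 :+ n) :* (con 5 :+ n) :+ (con 7 :+ con 6 :* n :+ n :* n)
                                                      := con 2 :* ((con 4 :+ n) :* (con 4 :+ n))) refl n ⟩
    2 * ((4 + n) * (4 + n))                      ≤⟨ *-monoʳ-≤ 2 ([4+n]²≤2^[4+n] n) ⟩
    2 ^ (5 + n)                                  ∎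
    where
    open ≤-Reasoning
    open +-*-Solver

  n²≤2^n : ∀ {n} → 4 ≤ n → n * n ≤ 2 ^ n
  n²≤2^n {n} 4≤n = subst (λ n → n * n ≤ 2 ^ n) (m+[n∸m]≡n 4≤n) ([4+n]²≤2^[4+n] (n ∸ 4))

  ^-distribʳ-* : ∀ m n o → (m * n) ^ o ≡ m ^ o * n ^ o
  ^-distribʳ-* m n zero    = refl
  ^-distribʳ-* m n (suc o) = trans (cong (m * n *_) (^-distribʳ-* m n o)) ([m*n]*[o*p]≡[m*o]*[n*p] m n (m ^ o) (n ^ o))

  m≤n*[1+m/n] : ∀ m n .{{_ : NonZero n}} → m ≤ n * suc (m / n)
  m≤n*[1+m/n] m n = begin
    m                    ≡⟨ m≡m%n+[m/n]*n m n ⟩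
    m % n + m / n * n    ≤⟨ +-monoˡ-≤ (m / n * n) (<⇒≤ (m%n<n m n)) ⟩
    n + m / n * n        ≡⟨ *-comm (suc (m / n)) n ⟩
    n * suc (m / n)      ∎
    where open ≤-Reasoning

  n*[1+m/n]≤m+n : ∀ m n .{{_ : NonZero n}} → n * suc (m / n) ≤ m + n
  n*[1+m/n]≤m+n m n = begin
    n * suc (m / n)      ≡⟨ *-comm n (suc (m / n)) ⟩
    n + m / n * n        ≤⟨ +-monoʳ-≤ n (m/n*n≤m m n) ⟩
    n + m                ≡⟨ +-comm n m ⟩
    m + n                ∎
    where open ≤-Reasoning

  module _ {d u R M e lg : ℕ} where
    private
      b = R * u
      f = e ∸ M

    open Balanced d b

    -- Both losses, k ^ (e - M) and the factor 2 b + 1 between 4 ^ b and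
    -- binomial b b raised to the power M, are at most 2 ^ (u M) = 2 ^ (b M / R).
    class-size : suc (2 * b) ≤ 2 ^ u → e * (d * d * R) ≤ M * suc (d * d * R) →
                 lg + (u * M + u * M) ≤ 2 * b * M → ∀ {t} → t ≤ 2 ^ lg → .{{_ : NonZero k}} → t * k ^ e ≤ N ^ M
    class-size b≤2^u eQ≤ lg≤ {t} t≤ = begin
      t * k ^ e                                    ≤⟨ *-mono-≤ t≤ (^-monoʳ-≤ k (m≤n+m∸n e M)) ⟩
      2 ^ lg * k ^ (M + f)                         ≡⟨ cong (2 ^ lg *_) (^-distribˡ-+-* k M f) ⟩
      2 ^ lg * (k ^ M * k ^ f)                     ≤⟨ *-monoʳ-≤ (2 ^ lg) (*-monoʳ-≤ (k ^ M) k^f≤) ⟩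
      2 ^ lg * (k ^ M * 2 ^ (u * M))               ≡⟨ solve 3 (λ a b c → a :* (b :* c) := b :* (a :* c)) refl (2 ^ lg) (k ^ M) (2 ^ (u * M)) ⟩
      k ^ M * (2 ^ lg * 2 ^ (u * M))               ≤⟨ *-monoʳ-≤ (k ^ M) small ⟩
      k ^ M * binomial b b ^ M                     ≡⟨ ^-distribʳ-* k (binomial b b) M ⟨
      (k * binomial b b) ^ M                       ≤⟨ ^-monoˡ-≤ M k*binomial≤N ⟩
      N ^ M                                        ∎
      where
      open ≤-Reasoning
      open +-*-Solver

      fQ≤M : f * (d * d * R) ≤ M
      fQ≤M = begin
        f * (d * d * R)                            ≡⟨ *-distribʳ-∸ (d * d * R) e M ⟩
        e * (d * d * R) ∸ M * (d * d * R)          ≤⟨ ∸-monoˡ-≤ (M * (d * d * R)) eQ≤ ⟩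
        M * suc (d * d * R) ∸ M * (d * d * R)      ≡⟨ cong (_∸ M * (d * d * R)) (*-suc M (d * d * R)) ⟩
        M + M * (d * d * R) ∸ M * (d * d * R)      ≡⟨ m+n∸n≡m M (M * (d * d * R)) ⟩
        M                                          ∎

      -- The bound `d ≤ 2 ^ d` is crude, but the factor `d * d` it leaves in the exponent is
      -- absorbed by the one in `fQ≤M`.
      k≤ : k ≤ 2 ^ (d * (d * b))
      k≤ = begin
        k                        ≤⟨ m/n≤m N (binomial b b) {{binomial-nonZero b b}} ⟩
        N                        ≤⟨ N≤d^[d*b] ⟩
        d ^ (d * b)              ≤⟨ ^-monoˡ-≤ (d * b) (n≤2^n d) ⟩
        (2 ^ d) ^ (d * b)        ≡⟨ ^-*-assoc 2 d (d * b) ⟩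
        2 ^ (d * (d * b))        ∎

      k^f≤ : k ^ f ≤ 2 ^ (u * M)
      k^f≤ = begin
        k ^ f                      ≤⟨ ^-monoˡ-≤ f k≤ ⟩
        (2 ^ (d * (d * b))) ^ f    ≡⟨ ^-*-assoc 2 (d * (d * b)) f ⟩
        2 ^ (d * (d * b) * f)      ≡⟨ cong (2 ^_) (solve 4 (λ d R u f → d :* (d :* (R :* u)) :* f := u :* (f :* (d :* d :* R))) refl d R u f) ⟩
        2 ^ (u * (f * (d * d * R)))  ≤⟨ ^-monoʳ-≤ 2 (*-monoʳ-≤ u fQ≤M) ⟩
        2 ^ (u * M)                ∎

      -- Multiplying by `2 ^ (u * M)`, an upper bound for (2 b + 1) ^ M, lets the estimate of
      -- `4 ^ b` be used without division.
      small : 2 ^ lg * 2 ^ (u * M) ≤ binomial b b ^ M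
      small = *-cancelʳ-≤ _ _ (2 ^ (u * M)) {{m^n≢0 2 (u * M)}} (begin
        2 ^ lg * 2 ^ (u * M) * 2 ^ (u * M)          ≡⟨ *-assoc (2 ^ lg) _ _ ⟩
        2 ^ lg * (2 ^ (u * M) * 2 ^ (u * M))        ≡⟨ cong (2 ^ lg *_) (^-distribˡ-+-* 2 (u * M) (u * M)) ⟨
        2 ^ lg * 2 ^ (u * M + u * M)                ≡⟨ ^-distribˡ-+-* 2 lg (u * M + u * M) ⟨
        2 ^ (lg + (u * M + u * M))                  ≤⟨ ^-monoʳ-≤ 2 lg≤ ⟩
        2 ^ (2 * b * M)                             ≡⟨ ^-*-assoc 2 (2 * b) M ⟨
        (2 ^ (2 * b)) ^ M                           ≡⟨ cong (_^ M) (^-*-assoc 2 2 b) ⟨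
        (4 ^ b) ^ M                                 ≤⟨ ^-monoˡ-≤ M (≤-trans (4^b≤binomial b) (*-monoʳ-≤ (binomial b b) b≤2^u)) ⟩
        (binomial b b * 2 ^ u) ^ M                  ≡⟨ ^-distribʳ-* (binomial b b) (2 ^ u) M ⟩
        binomial b b ^ M * (2 ^ u) ^ M              ≡⟨ cong (binomial b b ^ M *_) (^-*-assoc 2 u M) ⟩
        binomial b b ^ M * 2 ^ (u * M)              ∎)

  -- The first summand lets `ℓ` absorb the constant terms in `size-bound`; the second forces u ≥ 4 +
  -- 2 (P + 1), so that 2 b + 1, linear in u, is at most u² and hence at most 2 ^ u.
  threshold : ℕ → ℕ → ℕ
  threshold P M = (suc P * suc (2 * P * M) + 2 * P) + 2 * P * M * (4 + 2 * suc P)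

  module _ {P M ℓ u : ℕ} .{{_ : NonZero (2 * P * M)}} (threshold≤ℓ : threshold P M ≤ ℓ)
           (1+ℓ≤ : suc ℓ ≤ 2 * P * M * u) (≤1+ℓ : 2 * P * M * u ≤ suc ℓ + 2 * P * M) where
    open ≤-Reasoning
    open +-*-Solver

    1+2b≤2^u : suc (2 * (suc P * u)) ≤ 2 ^ u
    1+2b≤2^u = begin
      suc (2 * (suc P * u))          ≤⟨ +-monoˡ-≤ (2 * (suc P * u)) 1≤4u ⟩
      4 * u + 2 * (suc P * u)        ≡⟨ solve 2 (λ R u → con 4 :* u :+ con 2 :* (R :* u) := (con 4 :+ con 2 :* R) :* u) refl (suc P) u ⟩
      (4 + 2 * suc P) * u            ≤⟨ *-monoˡ-≤ u 4+2R≤u ⟩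
      u * u                          ≤⟨ n²≤2^n 4≤u ⟩
      2 ^ u                          ∎
      where
      4+2R≤u : 4 + 2 * suc P ≤ u
      4+2R≤u = *-cancelˡ-≤ (2 * P * M) (begin
        2 * P * M * (4 + 2 * suc P)  ≤⟨ m≤n+m _ (suc P * suc (2 * P * M) + 2 * P) ⟩
        threshold P M                ≤⟨ threshold≤ℓ ⟩
        ℓ                            ≤⟨ n≤1+n ℓ ⟩
        suc ℓ                        ≤⟨ 1+ℓ≤ ⟩
        2 * P * M * u                ∎)
      4≤u : 4 ≤ u
      4≤u = ≤-trans (m≤m+n 4 (2 * suc P)) 4+2R≤u
      1≤4u : 1 ≤ 4 * u
      1≤4u = ≤-trans (≤-trans (s≤s z≤n) 4≤u) (m≤n*m u 4)

    -- For b = (P + 1) u the exponent 2 b M splits into 2 P M u, which covers log₂ t, and 2 u M,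
    -- which pays for the two losses of u M each.
    lg-bound : suc ℓ + (u * M + u * M) ≤ 2 * (suc P * u) * M
    lg-bound = begin
      suc ℓ + (u * M + u * M)              ≤⟨ +-monoˡ-≤ (u * M + u * M) 1+ℓ≤ ⟩
      2 * P * M * u + (u * M + u * M)      ≡⟨ solve 3 (λ P M u → con 2 :* P :* M :* u :+ (u :* M :+ u :* M)
                                                := con 2 :* ((con 1 :+ P) :* u) :* M) refl P M u ⟩
      2 * (suc P * u) * M                  ∎

    -- The leading term is (P + 1) / (2 P) times D ℓ. The constants amount to at most one more `ℓ`,
    -- which makes the ratio (P + 2) / (2 P) = 1/2 + 1/P.
    size-bound : ∀ D → (M * (D * (suc P * u)) + D) * (2 * P) ≤ (2 + P) * (D * ℓ)
    size-bound D = begin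
      (M * (D * (suc P * u)) + D) * (2 * P)
        ≡⟨ solve 4 (λ M D u P → (M :* (D :* ((con 1 :+ P) :* u)) :+ D) :* (con 2 :* P)
             := D :* ((con 1 :+ P) :* (con 2 :* P :* M :* u) :+ con 2 :* P)) refl M D u P ⟩
      D * (suc P * (2 * P * M * u) + 2 * P)
        ≤⟨ *-monoʳ-≤ D (+-monoˡ-≤ (2 * P) (*-monoʳ-≤ (suc P) ≤1+ℓ)) ⟩
      D * (suc P * (suc ℓ + 2 * P * M) + 2 * P)
        ≡⟨ solve 4 (λ D P ℓ q → D :* ((con 1 :+ P) :* (con 1 :+ ℓ :+ q) :+ con 2 :* P)
             := D :* ((con 1 :+ P) :* ℓ :+ ((con 1 :+ P) :* (con 1 :+ q) :+ con 2 :* P))) refl D P ℓ (2 * P * M) ⟩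
      D * (suc P * ℓ + (suc P * suc (2 * P * M) + 2 * P))
        ≤⟨ *-monoʳ-≤ D (+-monoʳ-≤ (suc P * ℓ) (≤-trans (m≤m+n _ (2 * P * M * (4 + 2 * suc P))) threshold≤ℓ)) ⟩
      D * (suc P * ℓ + ℓ)
        ≡⟨ solve 3 (λ D P ℓ → D :* ((con 1 :+ P) :* ℓ :+ ℓ) := (con 2 :+ P) :* (D :* ℓ)) refl D P ℓ ⟩
      (2 + P) * (D * ℓ) ∎

  construction : ∀ d P → .{{NonZero P}} →
    ∃[ ℓ₀ ] ∀ t → ℓ₀ ≤ ⌊log₂ t ⌋ →
    ∃[ n ] Σ[ w ∈ (Fin t → Word (suc (suc d)) n) ] QualitativelyIndependent w ×
      (n + suc (suc d)) * (2 * P) ≤ (2 + P) * (suc (suc d) * ⌊log₂ t ⌋)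
  construction d P =
    let D = suc (suc d)
        -- The precision that `class-size` asks for with R = P + 1. It does not involve t, hence
        -- neither do `M`, `e` and the threshold.
        (M , e , M≢0 , eQ≤ , words) = independentWords d (D * D * suc P)
    in threshold P M , λ t threshold≤ → family M e M≢0 eQ≤ words t ⌊log₂ t ⌋ (n<2^[1+⌊log₂n⌋] t) threshold≤
    where
    D : ℕ
    D = suc (suc d)

    module _ (M e : ℕ) (M≢0 : NonZero M) (eQ≤ : e * (D * D * suc P) ≤ M * suc (D * D * suc P))
             (words : ∀ b t → t * Balanced.k D b ^ e ≤ Balanced.N D b ^ M →
                      Σ[ w ∈ (Fin t → Word D (M * (D * b))) ] QualitativelyIndependent w) where
      family : ∀ t ℓ → t < 2 ^ suc ℓ → threshold P M ≤ ℓ → ∃[ n ] Σ[ w ∈ (Fin t → Word D n) ]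
               QualitativelyIndependent w × (n + D) * (2 * P) ≤ (2 + P) * (D * ℓ)
      family t ℓ t< threshold≤ =
        let (w , independent) = words (suc P * u) t (class-size {D} {u} {suc P} {M} {e} {suc ℓ}
              (1+2b≤2^u {P} {M} threshold≤ 1+ℓ≤ ≤1+ℓ) eQ≤ (lg-bound {P} {M} threshold≤ 1+ℓ≤ ≤1+ℓ) (<⇒≤ t<)
              {{Balanced.k-nonZero D (suc P * u) {zero} {suc zero} λ ()}})
        in M * (D * (suc P * u)) , w , independent , size-bound {P} {M} threshold≤ 1+ℓ≤ ≤1+ℓ D
        where
        instance
          q≢0 : NonZero (2 * P * M)
          q≢0 = m*n≢0 (2 * P) M {{m*n≢0 2 P}} {{M≢0}}
        -- One more than the integer quotient puts 2 P M u between 1 + ℓ and 1 + ℓ + 2 P M.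
        u = suc (suc ℓ / (2 * P * M))
        1+ℓ≤ = m≤n*[1+m/n] (suc ℓ) (2 * P * M)
        ≤1+ℓ = n*[1+m/n]≤m+n (suc ℓ) (2 * P * M)

-- Rational estimates and passage to the reals

open import Defs
open import Data.Integer.Base as ℤ using (+_; +[1+_]; -[1+_]; +≤+)
import Data.Integer.Properties as ℤ
open import Data.Rational.Base as ℚ using (ℚ; mkℚ; 0ℚ; ½; toℚᵘ)
import Data.Rational.Properties as ℚ
open import Data.Rational.Unnormalised.Base as ℚᵘ using (mkℚᵘ; *≤*; *≡*)
import Data.Rational.Unnormalised.Properties as ℚᵘ
open Colourings using (Word)
open Families using (tupleOf; tupleOf-family; totalSize-tupleOf)
open Parameters using (construction)

frac : ℕ → ℕ → ℚ
frac a m = (+ a) ℚ./ suc m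

toℚᵘ-frac : ∀ a m → toℚᵘ (frac a m) ℚᵘ.≃ mkℚᵘ (+ a) m
toℚᵘ-frac a m = ℚ.toℚᵘ-fromℚᵘ (mkℚᵘ (+ a) m)

frac-mono-≤ : ∀ a m b n → a ℕ.* suc n ℕ.≤ b ℕ.* suc m → frac a m ℚ.≤ frac b n
frac-mono-≤ a m b n le = ℚ.toℚᵘ-cancel-≤
  (ℚᵘ.≤-respˡ-≃ (ℚᵘ.≃-sym (toℚᵘ-frac a m))
  (ℚᵘ.≤-respʳ-≃ (ℚᵘ.≃-sym (toℚᵘ-frac b n))
  (*≤* (subst₂ ℤ._≤_ (ℤ.pos-* a (suc n)) (ℤ.pos-* b (suc m)) (+≤+ le)))))

-- `n + m * suc n` is the predecessor of (m + 1) (n + 1), since `frac` takes denominators minus one.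
frac-* : ∀ a m b n → frac a m ℚ.* frac b n ≡ frac (a ℕ.* b) (n ℕ.+ m ℕ.* suc n)
frac-* a m b n = ℚ.toℚᵘ-injective (begin
  toℚᵘ (frac a m ℚ.* frac b n)                   ≈⟨ ℚ.toℚᵘ-homo-* (frac a m) (frac b n) ⟩
  toℚᵘ (frac a m) ℚᵘ.* toℚᵘ (frac b n)           ≈⟨ ℚᵘ.*-cong (toℚᵘ-frac a m) (toℚᵘ-frac b n) ⟩
  mkℚᵘ (+ a) m ℚᵘ.* mkℚᵘ (+ b) n                 ≈⟨ *≡* (cong (ℤ._* (+ (suc m ℕ.* suc n))) (sym (ℤ.pos-* a b))) ⟩
  mkℚᵘ (+ (a ℕ.* b)) (n ℕ.+ m ℕ.* suc n)         ≈⟨ toℚᵘ-frac (a ℕ.* b) (n ℕ.+ m ℕ.* suc n) ⟨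
  toℚᵘ (frac (a ℕ.* b) (n ℕ.+ m ℕ.* suc n))      ∎)
  where open ℚᵘ.≃-Reasoning

frac-+ : ∀ a m b n → frac a m ℚ.+ frac b n ≡ frac (a ℕ.* suc n ℕ.+ b ℕ.* suc m) (n ℕ.+ m ℕ.* suc n)
frac-+ a m b n = ℚ.toℚᵘ-injective (begin
  toℚᵘ (frac a m ℚ.+ frac b n)                   ≈⟨ ℚ.toℚᵘ-homo-+ (frac a m) (frac b n) ⟩
  toℚᵘ (frac a m) ℚᵘ.+ toℚᵘ (frac b n)           ≈⟨ ℚᵘ.+-cong (toℚᵘ-frac a m) (toℚᵘ-frac b n) ⟩
  mkℚᵘ (+ a) m ℚᵘ.+ mkℚᵘ (+ b) n                 ≈⟨ *≡* (cong (ℤ._* (+ (suc m ℕ.* suc n)))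
      (trans (cong₂ ℤ._+_ (sym (ℤ.pos-* a (suc n))) (sym (ℤ.pos-* b (suc m)))) (sym (ℤ.pos-+ (a ℕ.* suc n) (b ℕ.* suc m))))) ⟩
  mkℚᵘ (+ c) (n ℕ.+ m ℕ.* suc n)                 ≈⟨ toℚᵘ-frac c (n ℕ.+ m ℕ.* suc n) ⟨
  toℚᵘ (frac c (n ℕ.+ m ℕ.* suc n))              ∎)
  where
  open ℚᵘ.≃-Reasoning
  c = a ℕ.* suc n ℕ.+ b ℕ.* suc m

-- One of the two fractions goes into the constant `C`, the other is the gap that the strict
-- inequality requires. For δ = (a + 1) / (d + 1) the choice p + 1 = 2 (d + 1) makes their sum 1 /
-- (d + 1).
archimedean : ∀ δ → 0ℚ ℚ.< δ → ∃[ p ] frac 1 p ℚ.+ frac 1 p ℚ.≤ δ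
archimedean (mkℚ (+ zero) d c)  0<δ = contradiction (ℚ.positive 0<δ) λ ()
archimedean (mkℚ -[1+ a ] d c)  0<δ = contradiction (ℚ.positive 0<δ) λ ()
archimedean δ@(mkℚ +[1+ a ] d c) 0<δ = suc (2 ℕ.* d) , subst₂ ℚ._≤_ (sym (frac-+ 1 p 1 p)) (ℚ.↥p/↧p≡p δ)
  (frac-mono-≤ (1 ℕ.* suc p ℕ.+ 1 ℕ.* suc p) (p ℕ.+ p ℕ.* suc p) (suc a) d (begin
    (1 ℕ.* suc p ℕ.+ 1 ℕ.* suc p) ℕ.* suc d   ≡⟨ solve 1 (λ d → (con 1 :* (con 2 :+ con 2 :* d) :+ con 1 :* (con 2 :+ con 2 :* d)) :* (con 1 :+ d)
                                                   := (con 2 :+ con 2 :* d) :* (con 2 :+ con 2 :* d)) refl d ⟩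
    suc p ℕ.* suc p                           ≤⟨ ℕ.m≤n*m (suc p ℕ.* suc p) (suc a) ⟩
    suc a ℕ.* (suc p ℕ.* suc p)               ∎))
  where
  p = suc (2 ℕ.* d)
  open ℕ.≤-Reasoning
  open +-*-Solver

-- From 2 ^ ⌊log₂ t⌋ ≤ t by taking n-th powers. Consequently every approximant of `log₂ t` is at
-- least its integer part.
⌊log₂⌋*≤⌊log₂^⌋ : ∀ t n → 1 ℕ.≤ t → ⌊log₂ t ⌋ ℕ.* n ℕ.≤ ⌊log₂ t ℕ.^ n ⌋
⌊log₂⌋*≤⌊log₂^⌋ t n 1≤t = begin
  ⌊log₂ t ⌋ ℕ.* n                      ≡⟨ ⌊log₂[2^n]⌋≡n (⌊log₂ t ⌋ ℕ.* n) ⟨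
  ⌊log₂ 2 ℕ.^ (⌊log₂ t ⌋ ℕ.* n) ⌋      ≡⟨ cong ⌊log₂_⌋ (ℕ.^-*-assoc 2 ⌊log₂ t ⌋ n) ⟨
  ⌊log₂ (2 ℕ.^ ⌊log₂ t ⌋) ℕ.^ n ⌋      ≤⟨ ⌊log₂⌋-mono-≤ (ℕ.^-monoˡ-≤ n (2^⌊log₂n⌋≤n t 1≤t)) ⟩
  ⌊log₂ t ℕ.^ n ⌋                      ∎
  where open ℕ.≤-Reasoning

-- The size bound with constant (p + 3) / (2 (p + 1)) = 1/2 + 1 / (p + 1), cross-multiplied. The
-- factors 1 are those that `frac-+` and `frac-*` produce.
cleared-bound : ∀ X D t p n l a → X ℕ.* (2 ℕ.* suc p) ℕ.≤ (3 ℕ.+ p) ℕ.* (D ℕ.* t ℕ.* l) → l ℕ.* suc n ℕ.≤ a →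
  X ℕ.* (suc n ℕ.+ (p ℕ.+ 1 ℕ.* suc p) ℕ.* 1 ℕ.* 1 ℕ.* suc n)
  ℕ.≤ (1 ℕ.* suc p ℕ.+ 1 ℕ.* 2) ℕ.* D ℕ.* t ℕ.* a ℕ.* 1
cleared-bound X D t p n l a h ln≤a = begin
  X ℕ.* (suc n ℕ.+ (p ℕ.+ 1 ℕ.* suc p) ℕ.* 1 ℕ.* 1 ℕ.* suc n)
    ≡⟨ solve 3 (λ X p n → X :* ((con 1 :+ n) :+ (p :+ con 1 :* (con 1 :+ p)) :* con 1 :* con 1 :* (con 1 :+ n))
         := X :* (con 2 :* (con 1 :+ p)) :* (con 1 :+ n)) refl X p n ⟩
  X ℕ.* (2 ℕ.* suc p) ℕ.* suc n
    ≤⟨ ℕ.*-monoˡ-≤ (suc n) h ⟩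
  (3 ℕ.+ p) ℕ.* (D ℕ.* t ℕ.* l) ℕ.* suc n
    ≡⟨ solve 5 (λ p D t l n → (con 3 :+ p) :* (D :* t :* l) :* (con 1 :+ n)
         := (con 3 :+ p) :* D :* t :* (l :* (con 1 :+ n))) refl p D t l n ⟩
  (3 ℕ.+ p) ℕ.* D ℕ.* t ℕ.* (l ℕ.* suc n)
    ≤⟨ ℕ.*-monoʳ-≤ ((3 ℕ.+ p) ℕ.* D ℕ.* t) ln≤a ⟩
  (3 ℕ.+ p) ℕ.* D ℕ.* t ℕ.* a
    ≡⟨ solve 4 (λ p D t a → (con 3 :+ p) :* D :* t :* a
         := (con 1 :* (con 1 :+ p) :+ con 1 :* con 2) :* D :* t :* a :* con 1) refl p D t a ⟩
  (1 ℕ.* suc p ℕ.+ 1 ℕ.* 2) ℕ.* D ℕ.* t ℕ.* a ℕ.* 1 ∎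
  where
  open ℕ.≤-Reasoning
  open +-*-Solver

product-bound : ∀ {X D t} p → 1 ℕ.≤ t → X ℕ.* (2 ℕ.* suc p) ℕ.≤ (3 ℕ.+ p) ℕ.* (D ℕ.* t ℕ.* ⌊log₂ t ⌋) →
  fromℕ X ≤ fromℚ (½ ℚ.+ frac 1 p) * fromℕ D * fromℕ t * log₂ t
-- The bound holds at every index without slack, so the index 0 serves for all δ.
product-bound {X} {D} {t} p 1≤t h δ 0<δ = 0 , λ n _ → begin
  frac X 0
    ≤⟨ frac-mono-≤ X 0 (s ℕ.* D ℕ.* t ℕ.* a n) _ (cleared-bound X D t p n ⌊log₂ t ⌋ (a n) h (⌊log₂⌋*≤⌊log₂^⌋ t (suc n) 1≤t)) ⟩
  frac (s ℕ.* D ℕ.* t ℕ.* a n) _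
    ≡⟨ frac-* (s ℕ.* D ℕ.* t) _ (a n) n ⟨
  frac (s ℕ.* D ℕ.* t) _ ℚ.* log₂-seq t n
    ≡⟨ cong (ℚ._* log₂-seq t n) (frac-* (s ℕ.* D) _ t 0) ⟨
  frac (s ℕ.* D) _ ℚ.* frac t 0 ℚ.* log₂-seq t n
    ≡⟨ cong (λ r → r ℚ.* frac t 0 ℚ.* log₂-seq t n) (frac-* s _ D 0) ⟨
  frac s r ℚ.* frac D 0 ℚ.* frac t 0 ℚ.* log₂-seq t n
    ≡⟨ cong (λ q → q ℚ.* frac D 0 ℚ.* frac t 0 ℚ.* log₂-seq t n) (frac-+ 1 1 1 p) ⟨
  bound n              ≡⟨ ℚ.+-identityʳ (bound n) ⟨
  bound n ℚ.+ 0ℚ       ≤⟨ ℚ.+-monoʳ-≤ (bound n) (ℚ.<⇒≤ 0<δ) ⟩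
  bound n ℚ.+ δ        ∎
  where
  open ℚ.≤-Reasoning
  a : ℕ → ℕ
  a n = ⌊log₂ t ℕ.^ suc n ⌋
  s = 1 ℕ.* suc p ℕ.+ 1 ℕ.* 2
  r = p ℕ.+ 1 ℕ.* suc p
  bound : ℕ → ℚ
  bound n = (½ ℚ.+ frac 1 p) ℚ.* frac D 0 ℚ.* frac t 0 ℚ.* log₂-seq t n

2^n≤m⇒n≤⌊log₂m⌋ : ∀ {n m} → 2 ℕ.^ n ℕ.≤ m → n ℕ.≤ ⌊log₂ m ⌋
2^n≤m⇒n≤⌊log₂m⌋ {n} 2^n≤m = subst (ℕ._≤ _) (⌊log₂[2^n]⌋≡n n) (⌊log₂⌋-mono-≤ 2^n≤m)

theorem6 : (d : ℕ) → 2 ℕ.≤ d →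
    (ε : ℝ) → fromℚ 0ℚ < ε →
    Σ[ C ∈ ℝ ] (C < fromℚ ½ + ε) ×
    (Σ[ t₀ ∈ ℕ ] ((t : ℕ) → t₀ ℕ.≤ t →
    Σ[ n ∈ ℕ ] Σ[ A ∈ Family t d n ]
    DisjointExactlyWithinTuples A ×
    (fromℕ (totalSize A) ≤ C * fromℕ d * fromℕ t * log₂ t)))
theorem6 D@(suc (suc d)) (s≤s (s≤s _)) ε (δ , 0<δ , N , δ≤ε) =
  let (p , 2/p≤δ) = archimedean δ 0<δ
      -- With P = p + 1 the ratio (2 + P) / (2 P) of the construction is exactly the constant 1/2 +
      -- 1 / (p + 1).
      (ℓ₀ , words) = construction d (suc p)
  in fromℚ (½ ℚ.+ frac 1 p)
   , (frac 1 p , ℚ.positive⁻¹ (frac 1 p) {{ℚ.normalize-pos 1 (suc p)}} , N , λ n N≤n → begin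
       ½ ℚ.+ frac 1 p ℚ.+ frac 1 p      ≡⟨ ℚ.+-assoc ½ (frac 1 p) (frac 1 p) ⟩
       ½ ℚ.+ (frac 1 p ℚ.+ frac 1 p)    ≤⟨ ℚ.+-monoʳ-≤ ½ 2/p≤δ ⟩
       ½ ℚ.+ δ                          ≡⟨ cong (½ ℚ.+_) (ℚ.+-identityˡ δ) ⟨
       ½ ℚ.+ (0ℚ ℚ.+ δ)                 ≤⟨ ℚ.+-monoʳ-≤ ½ (δ≤ε n N≤n) ⟩
       ½ ℚ.+ seq ε n                    ∎)
   -- A power of 2 turns t ≥ t₀ into ⌊log₂ t⌋ ≥ ℓ₀, and it also gives t ≥ 1.
   , 2 ℕ.^ ℓ₀
   , λ t 2^ℓ₀≤t →
     let (n , w , independent , size) = words t (2^n≤m⇒n≤⌊log₂m⌋ 2^ℓ₀≤t)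
     in n ℕ.+ D , (λ i → tupleOf (w i)) , tupleOf-family w independent
      , product-bound {totalSize (λ i → tupleOf (w i))} {D} {t} p (ℕ.≤-trans (ℕ.m^n>0 2 ℓ₀) 2^ℓ₀≤t)
          (total-bound {t} {n} {⌊log₂ t ⌋} w p size)
  where
  open ℚ.≤-Reasoning

  total-bound : ∀ {t n l} (w : Fin t → Word D n) p →
    (n ℕ.+ D) ℕ.* (2 ℕ.* suc p) ℕ.≤ (3 ℕ.+ p) ℕ.* (D ℕ.* l) →
    totalSize (λ i → tupleOf (w i)) ℕ.* (2 ℕ.* suc p) ℕ.≤ (3 ℕ.+ p) ℕ.* (D ℕ.* t ℕ.* l)
  total-bound {t} {n} {l} w p size = subst₂ ℕ._≤_
    (trans (sym (ℕ.*-assoc t (n ℕ.+ D) (2 ℕ.* suc p))) (cong (ℕ._* (2 ℕ.* suc p)) (sym (totalSize-tupleOf w))))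
    (solve 4 (λ t p D l → t :* ((con 3 :+ p) :* (D :* l)) := (con 3 :+ p) :* (D :* t :* l)) refl t p D l)
    (ℕ.*-monoʳ-≤ t size)
    where open +-*-Solver
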